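{- For all positive integers $t,r$ there exists a number $f(t,r)$ such that every $(6t-4)$-edge-connected graph with at least $f(t,r)$ vertices contains $C_{t,r}$ as an immersion.
   Context: All graphs are finite and loopless but may have multiple edges. $C_{t,r}$ denotes the graph obtained from a cycle on $r$ vertices by replacing each edge with a class of $t$ parallel edges. A graph $H$ is (weakly) immersed in $G$ if there is an injective map from $V(H)$ to $V(G)$ and an assignment to each edge $uv$ of $H$ of a path in $G$ between the images of $u$ and $v$, with the paths for distinct edges pairwise edge-disjoint; equivalently, a graph isomorphic to $H$ can be obtained from a subgraph of $G$ by repeatedly lifting pairs of adjacent edges (replacing $uv,vw$ by a new edge $uw$, deleting it if it is a loop). -}

module Defs where

open import Data.Nat using (ℕ; zero; suc; _*_; _<_)
open import Data.Nat.DivMod using (_mod_)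
open import Data.Fin using (Fin; toℕ; quotient)
open import Data.Fin.Subset using (Subset; _∉_; ∣_∣)
open import Data.Product using (Σ; ∃; _×_; _,_; proj₁; proj₂)
open import Data.List using (List; []; _∷_)
open import Data.List.Relation.Unary.All using (All)
open import Data.List.Relation.Unary.Unique.Propositional using (Unique)
import Data.List.Membership.Propositional as LM
open import Data.Sum using (_⊎_)
open import Data.Empty using (⊥)
open import Relation.Binary.PropositionalEquality using (_≡_; _≢_)
open import Function.Definitions using (Injective)

-- A finite multigraph: vertices Fin nV, edges Fin nE, each edge with
-- an (unordered, stored as a pair) set of two end vertices.
record Graph : Set where
  constructor graph
  field
    nV   : ℕ
    nE   : ℕ
    ends : Fin nE → Fin nV × Fin nV
open Graph public

Loopless : Graph → Set
Loopless G = ∀ (e : Fin (nE G)) → proj₁ (ends G e) ≢ proj₂ (ends G e)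

Joins : (G : Graph) → Fin (nE G) → Fin (nV G) → Fin (nV G) → Set
Joins G e u w = ends G e ≡ (u , w) ⊎ ends G e ≡ (w , u)

data Walk (G : Graph) : Fin (nV G) → Fin (nV G) → Set where
  nil  : ∀ {u} → Walk G u u
  cons : ∀ {u w v} (e : Fin (nE G)) → Joins G e u w → Walk G w v → Walk G u v

walkEdges : ∀ {G u v} → Walk G u v → List (Fin (nE G))
walkEdges nil          = []
walkEdges (cons e _ p) = e ∷ walkEdges p

walkVertices : ∀ {G u v} → Walk G u v → List (Fin (nV G))
walkVertices {u = u} nil          = u ∷ []
walkVertices {u = u} (cons _ _ p) = u ∷ walkVertices p

IsPath : ∀ {G u v} → Walk G u v → Set
IsPath p = Unique (walkVertices p)

EdgeConnected : ℕ → Graph → Set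
EdgeConnected k G =
  (F : Subset (nE G)) → ∣ F ∣ < k →
  (u v : Fin (nV G)) → Σ (Walk G u v) (λ p → All (λ e → e ∉ F) (walkEdges p))

Immersed : Graph → Graph → Set
Immersed H G =
  Σ (Fin (nV H) → Fin (nV G)) λ φ →
  Injective _≡_ _≡_ φ ×
  Σ ((h : Fin (nE H)) → Walk G (φ (proj₁ (ends H h))) (φ (proj₂ (ends H h)))) λ P →
    (∀ h → IsPath (P h)) ×
    (∀ h h' → h ≢ h' → ∀ e → e LM.∈ walkEdges (P h) → e LM.∈ walkEdges (P h') → ⊥)

-- C_{t,r}: cycle on r vertices, each edge replaced by t parallel edges.
-- Edge (i , j) with i : Fin r, j : Fin t joins i and i+1 mod r.
-- For r = 1 the cycle edge would be a loop; loops are deleted, so C_{t,1}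
-- is a single vertex. For r = 0 it is the empty graph (not used).
C : ℕ → ℕ → Graph
C t zero          = graph 0 0 (λ ())
C t (suc zero)    = graph 1 0 (λ ())
C t (suc (suc k)) = graph (suc (suc k)) (suc (suc k) * t)
  (λ e → quotient t e , (suc (toℕ (quotient {suc (suc k)} t e))) mod (suc (suc k)))

{-# OPTIONS --safe #-}
-- For t ≥ 2, a (6t − 4)-edge-connected graph is 4t-edge-connected, so its edges split into 2t
-- connected spanning classes. In the union of two classes A and B, adding (mod 2) to every edge of A
-- a B-walk between its ends gives an even set containing A, hence a closed trail through all vertices.
-- This yields t edge-disjoint spanning closed trails, and by Erdős–Szekeres r vertices that all of
-- them meet in the same cyclic order up to reversal: these are the branch vertices of C_{t,r}.
-- For t = 1 the graph is only 2-edge-connected, but one closed trail through many vertices suffices: it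
-- is found through two vertices that are far apart, or at a vertex with many neighbours.
module Submission where

open import Defs
open import Algebra.Bundles using (CommutativeRing)
open import Data.Bool using (Bool; true; false; _xor_; _∧_; if_then_else_)
open import Data.Bool.Properties as Boolₚ using (xor-same; xor-comm; xor-identityʳ; ∧-distribʳ-xor; xor-∧-commutativeRing)
open import Data.Empty using (⊥; ⊥-elim)
open import Data.Fin as Fin using (Fin; zero; suc; toℕ; fromℕ<; inject≤; punchIn; punchOut; quotient; remainder; combine)
open import Data.Fin.Properties as Finₚ
  using (any?; ¬∀⟶∃¬; pigeonhole; toℕ-fromℕ<; toℕ-inject≤; toℕ<n; toℕ-injective; punchOut-cong; punchOut-injective;
         punchOut-punchIn; punchInᵢ≢i; combine-remQuot; combine-injectiveˡ; combine-injectiveʳ)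
open import Data.Fin.Subset as Subset using (Subset; ∣_∣; ⁅_⁆)
open import Data.Fin.Subset.Properties using (∣⁅x⁆∣≡1; ∣⊥∣≡0; x∈⁅x⁆)
open import Data.List using (List; []; _∷_; _++_; length; filter; tabulate; lookup; allFin; concatMap)
open import Data.List.Properties using (length-++; length-tabulate)
open import Data.List.Membership.Propositional using (_∈_; _∉_; lose)
open import Data.List.Membership.Propositional.Properties
  using (∈-++⁺ˡ; ∈-++⁺ʳ; ∈-++⁻; ∈-filter⁺; ∈-filter⁻; ∈-allFin; ∈-concatMap⁺; ∈-lookup)
open import Data.List.Relation.Binary.Permutation.Propositional using (_↭_; ↭-sym; ↭⇒↭ₛ)
open import Data.List.Relation.Binary.Permutation.Propositional.Properties using (shifts; ∈-resp-↭)
import Data.List.Relation.Binary.Permutation.Setoid.Properties as Permₛ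
open import Data.List.Relation.Binary.Sublist.Propositional using (_⊆_; []; _∷_; _∷ʳ_; ⊆-trans; ⊆-refl; minimum)
open import Data.List.Relation.Binary.Sublist.Propositional.Properties using (filter-⊆; All-resp-⊆)
open import Data.List.Relation.Unary.All as All using (All; []; _∷_)
import Data.List.Relation.Unary.All.Properties as Allₚ
open import Data.List.Relation.Unary.AllPairs using (AllPairs; []; _∷_)
open import Data.List.Relation.Unary.Any using (here; there; index)
open import Data.List.Relation.Unary.Any.Properties using (lookup-index)
open import Data.List.Relation.Unary.Unique.Propositional using (Unique)
import Data.List.Relation.Unary.Unique.Propositional.Properties as Uniqueₚ
open import Data.Nat using (ℕ; zero; suc; _+_; _*_; _∸_; _^_; _≤_; _<_; _≥_; _>_; z≤n; s≤s; s≤s⁻¹)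
open import Data.Nat.DivMod using (_mod_; _%_; m<n⇒m%n≡m; n%n≡0)
open import Data.Nat.Properties
open import Data.Nat.Solver using (module +-*-Solver)
open import Data.Product using (Σ; ∃; _×_; _,_; proj₁; proj₂)
open import Data.Product.Properties using (≡-dec)
open import Data.Sum using (_⊎_; inj₁; inj₂; swap; map₁; [_,_]′)
open import Data.Unit using (⊤; tt)
open import Data.Vec as Vec using (Vec; []; _∷_; _[_]≔_)
open import Data.Vec.Properties using (lookup∘update; lookup∘update′; lookup∘tabulate; lookup⇒[]=)
open import Function using (_∘_; id; _on_)
open import Function.Definitions using (Injective)
open import Relation.Binary using (tri<; tri≈; tri>)
open import Relation.Binary.PropositionalEquality
open import Relation.Nullary using (¬_; Dec; yes; no; does)
open import Relation.Nullary.Decidable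
  using (map′; ¬?; _×-dec_; _⊎-dec_; decidable-stable; dec-true; dec-false; ¬¬-excluded-middle)
open import Relation.Unary using (Decidable)
open import Algebra.Properties.CommutativeMonoid.Sum +-0-commutativeMonoid using (sum; ∑-comm; ∑-distrib-+)
open import Algebra.Properties.CommutativeMonoid.Sum (CommutativeRing.+-commutativeMonoid xor-∧-commutativeRing)
  using () renaming (sum to ⨁; ∑-distrib-+ to ⨁-distrib-xor; sum-cong-≗ to ⨁-cong)

-- The splitting is the theorem of Nash-Williams and Tutte in its edge-connectivity form. It is
-- proved by exchange: choose a colouring with the most linked pairs, and count the edges between
-- components of those edges that can be recoloured at no cost. Closed trails can replace cycles
-- because an immersion asks only for edge-disjointness: the arcs of a closed trail between
-- successive branch vertices are edge-disjoint even where they share vertices, and each arc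
-- shortens to a path. So every trail supplies one copy of the cycle. A trail may visit a vertex
-- repeatedly; fixing one visit per vertex turns it into a linear order, to which Erdős-Szekeres
-- applies. Reversal is harmless since paths have no direction, and the arc from the last branch
-- vertex to the first runs through the base point. Two classes per trail would ask for
-- edge-connectivity 4 at t = 1, and a long cycle, though 2-edge-connected, does not split into two
-- connected spanning classes; hence the separate argument there.

-- Pigeonhole and counting for lists

module _ {A : Set} where

  AllPairs-resp-⊆ : ∀ {R : A → A → Set} {xs ys : List A} → xs ⊆ ys → AllPairs R ys → AllPairs R xs
  AllPairs-resp-⊆ []          []       = []
  AllPairs-resp-⊆ (y ∷ʳ τ)    (_ ∷ ps) = AllPairs-resp-⊆ τ ps
  AllPairs-resp-⊆ (refl ∷ τ)  (p ∷ ps) = All-resp-⊆ τ p ∷ AllPairs-resp-⊆ τ ps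

  AllPairs-lookup : ∀ {R : A → A → Set} {xs : List A} → AllPairs R xs →
                    ∀ {i j} → i Fin.< j → R (lookup xs i) (lookup xs j)
  AllPairs-lookup {xs = x ∷ xs} (p ∷ ps) {zero}  {suc j} _         = All.lookup p (∈-lookup {xs = xs} j)
  AllPairs-lookup {xs = x ∷ xs} (p ∷ ps) {suc i} {suc j} (s≤s i<j) = AllPairs-lookup ps i<j

  length-filter-split : ∀ {P : A → Set} (P? : Decidable P) xs →
    length xs ≡ length (filter P? xs) + length (filter (¬? ∘ P?) xs)
  length-filter-split P? [] = refl
  length-filter-split P? (x ∷ xs) with P? x
  ... | yes _ = cong suc (length-filter-split P? xs)
  ... | no  _ = trans (cong suc (length-filter-split P? xs)) (sym (+-suc _ _))

  -- A relation instead of a map lets each element choose its partner together with data about the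
  -- choice. Both witnesses are returned: `longer-star-trail` needs the two excursions, not only
  -- their common end.
  list-pigeonhole : ∀ {B : Set} (R : A → B → Set) {xs : List A} (ys : List B) → Unique xs →
    (∀ {x} → x ∈ xs → ∃ λ y → y ∈ ys × R x y) → length ys < length xs →
    ∃ λ x → ∃ λ x′ → x ∈ xs × x′ ∈ xs × x ≢ x′ × ∃ λ y → R x y × R x′ y
  list-pigeonhole R {xs} ys u φ ys<xs = go (pigeonhole ys<xs f)
    where
    img : ∀ i → ∃ λ y → y ∈ ys × R (lookup xs i) y
    img i = φ (∈-lookup {xs = xs} i)
    f : Fin (length xs) → Fin (length ys)
    f i = index (proj₁ (proj₂ (img i)))
    rel : ∀ i → R (lookup xs i) (lookup ys (f i))
    rel i = subst (R _) (lookup-index (proj₁ (proj₂ (img i)))) (proj₂ (proj₂ (img i)))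
    go : _ → _
    go (i , j , i<j , eq) = lookup xs i , lookup xs j , ∈-lookup {xs = xs} i , ∈-lookup {xs = xs} j
      , AllPairs-lookup u i<j , lookup ys (f i) , rel i , subst (λ k → R _ (lookup ys k)) (sym eq) (rel j)

  unique-length-≤ : ∀ {xs ys : List A} → Unique xs → All (_∈ ys) xs → length xs ≤ length ys
  unique-length-≤ {xs} {ys} u s = ≮⇒≥ λ ys<xs →
    let _ , _ , _ , _ , x≢x′ , _ , x≡y , x′≡y = list-pigeonhole _≡_ ys u (λ x∈ → _ , All.lookup s x∈ , refl) ys<xs
    in x≢x′ (trans x≡y (sym x′≡y))

-- Erdős–Szekeres, with the cruder bound that comes from splitting on the first element.
monotoneBound : ℕ → ℕ → ℕ
monotoneBound zero    b       = 0
monotoneBound (suc a) zero    = 0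
monotoneBound (suc a) (suc b) = suc (monotoneBound a (suc b) + monotoneBound (suc a) b)

module _ {A : Set} where

  Separates : (A → ℕ) → List A → Set
  Separates f = AllPairs (λ x y → f x ≢ f y)

  Monotone : (A → ℕ) → List A → Set
  Monotone f xs = AllPairs (_<_ on f) xs ⊎ AllPairs (_>_ on f) xs

  -- All later values lie above or below that of `x`, and one of the two parts reaches its share of
  -- the bound. An increasing sublist of `above` or a decreasing one of `below` can be prefixed by
  -- `x`; in the other outcomes the sublist is already long enough.
  monotone-sublist : (f : A → ℕ) → ∀ a b xs → Separates f xs → monotoneBound a b ≤ length xs →
    (∃ λ ys → ys ⊆ xs × length ys ≡ a × AllPairs (_<_ on f) ys) ⊎
    (∃ λ ys → ys ⊆ xs × length ys ≡ b × AllPairs (_>_ on f) ys)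
  monotone-sublist f zero    b       xs       sep le = inj₁ ([] , minimum xs , refl , [])
  monotone-sublist f (suc a) zero    xs       sep le = inj₂ ([] , minimum xs , refl , [])
  monotone-sublist f (suc a) (suc b) (x ∷ xs) (x≢ ∷ sep) (s≤s le) = go (≤-<-connex (monotoneBound a (suc b)) (length above))
    where
    above below : List A
    above = filter (λ y → f x <? f y) xs
    below = filter (¬? ∘ λ y → f x <? f y) xs
    above⊆ = filter-⊆ (λ y → f x <? f y) xs
    below⊆ = filter-⊆ (¬? ∘ λ y → f x <? f y) xs
    above< : All (λ y → f x < f y) above
    above< = Allₚ.all-filter (λ y → f x <? f y) xs
    below> : All (λ y → f x > f y) below
    below> = All.zipWith (λ (≢ , ≮) → ≤∧≢⇒< (≮⇒≥ ≮) (≢ ∘ sym))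
               (All-resp-⊆ below⊆ x≢ , Allₚ.all-filter (¬? ∘ λ y → f x <? f y) xs)
    go : monotoneBound a (suc b) ≤ length above ⊎ length above < monotoneBound a (suc b) → _
    go (inj₁ le′) with monotone-sublist f a (suc b) above (AllPairs-resp-⊆ above⊆ sep) le′
    ... | inj₁ (ys , τ , l , m) = inj₁ (x ∷ ys , refl ∷ ⊆-trans τ above⊆ , cong suc l , All-resp-⊆ τ above< ∷ m)
    ... | inj₂ (ys , τ , l , m) = inj₂ (ys , x ∷ʳ ⊆-trans τ above⊆ , l , m)
    go (inj₂ gt) with monotone-sublist f (suc a) b below (AllPairs-resp-⊆ below⊆ sep)
      (+-cancelˡ-≤ _ _ _ (≤-trans le (≤-trans (≤-reflexive (length-filter-split (λ y → f x <? f y) xs)) (+-monoˡ-≤ _ (<⇒≤ gt)))))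
    ... | inj₁ (ys , τ , l , m) = inj₁ (ys , x ∷ʳ ⊆-trans τ below⊆ , l , m)
    ... | inj₂ (ys , τ , l , m) = inj₂ (x ∷ ys , refl ∷ ⊆-trans τ below⊆ , cong suc l , All-resp-⊆ τ below> ∷ m)

commonBound : ℕ → ℕ → ℕ
commonBound zero    r = r
commonBound (suc t) r = monotoneBound (commonBound t r) (commonBound t r)

module _ {A : Set} where

  -- Each function is treated inside the sublist left by the previous one, since monotonicity passes
  -- to sublists. The equal arguments in `commonBound` ensure that either direction leaves enough
  -- elements.
  common-monotone-sublist : ∀ t r (f : Fin t → A → ℕ) xs → (∀ i → Separates (f i) xs) →
    commonBound t r ≤ length xs → ∃ λ ys → ys ⊆ xs × r ≤ length ys × (∀ i → Monotone (f i) ys)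
  common-monotone-sublist zero    r f xs sep le = xs , ⊆-refl , le , λ ()
  common-monotone-sublist (suc t) r f xs sep le
    with monotone-sublist (f zero) (commonBound t r) (commonBound t r) xs (sep zero) le
  ... | inj₁ (ys , τ , l , m)
    with zs , σ , l′ , ms ← common-monotone-sublist t r (f ∘ suc) ys (AllPairs-resp-⊆ τ ∘ sep ∘ suc) (≤-reflexive (sym l))
    = zs , ⊆-trans σ τ , l′ , λ { zero → inj₁ (AllPairs-resp-⊆ σ m) ; (suc i) → ms i }
  ... | inj₂ (ys , τ , l , m)
    with zs , σ , l′ , ms ← common-monotone-sublist t r (f ∘ suc) ys (AllPairs-resp-⊆ τ ∘ sep ∘ suc) (≤-reflexive (sym l))
    = zs , ⊆-trans σ τ , l′ , λ { zero → inj₂ (AllPairs-resp-⊆ σ m) ; (suc i) → ms i }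

-- Indicator sums

𝟙 : ∀ {P : Set} → Dec P → ℕ
𝟙 P? = if does P? then 1 else 0

𝟙-mono : ∀ {P Q : Set} (P? : Dec P) (Q? : Dec Q) → (P → Q) → 𝟙 P? ≤ 𝟙 Q?
𝟙-mono (yes p) (yes q) f = ≤-refl
𝟙-mono (yes p) (no ¬q) f = ⊥-elim (¬q (f p))
𝟙-mono (no ¬p) Q?      f = z≤n

𝟙-reflects-≤ : ∀ {P Q : Set} (P? : Dec P) (Q? : Dec Q) → 𝟙 P? ≤ 𝟙 Q? → P → Q
𝟙-reflects-≤ (yes p) (yes q) le _ = q
𝟙-reflects-≤ (no ¬p) Q?      le p = ⊥-elim (¬p p)

length-filter-tabulate : ∀ {A : Set} {P : A → Set} (P? : Decidable P) {n} (f : Fin n → A) →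
  length (filter P? (tabulate f)) ≡ sum (λ i → 𝟙 (P? (f i)))
length-filter-tabulate P? {zero}  f = refl
length-filter-tabulate P? {suc n} f with P? (f zero)
... | yes _ = cong suc (length-filter-tabulate P? (f ∘ suc))
... | no  _ = length-filter-tabulate P? (f ∘ suc)

∣tabulate∣ : ∀ {n} {P : Fin n → Set} (P? : Decidable P) → ∣ Vec.tabulate (does ∘ P?) ∣ ≡ sum (λ i → 𝟙 (P? i))
∣tabulate∣ {zero}  P? = refl
∣tabulate∣ {suc n} P? with does (P? zero)
... | true  = cong suc (∣tabulate∣ (P? ∘ suc))
... | false = ∣tabulate∣ (P? ∘ suc)

sum-mono-≤ : ∀ {n} {f g : Fin n → ℕ} → (∀ i → f i ≤ g i) → sum f ≤ sum g
sum-mono-≤ {zero}  le = z≤n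
sum-mono-≤ {suc n} le = +-mono-≤ (le zero) (sum-mono-≤ (le ∘ suc))

sum-const : ∀ n c → sum {n} (λ _ → c) ≡ n * c
sum-const zero    c = refl
sum-const (suc n) c = cong (c +_) (sum-const n c)

-- With termwise inequality one way and totals the other way, no term has slack. This turns the
-- maximality of a total into a statement about every single term.
sum-squeeze : ∀ {n} {f g : Fin n → ℕ} → (∀ i → f i ≤ g i) → sum g ≤ sum f → ∀ i → g i ≤ f i
sum-squeeze {suc n} {f} {g} le ge zero    =
  +-cancelʳ-≤ _ _ _ (≤-trans ge (+-monoʳ-≤ (f zero) (sum-mono-≤ (le ∘ suc))))
sum-squeeze {suc n} {f} {g} le ge (suc i) = sum-squeeze (le ∘ suc)
  (+-cancelˡ-≤ (g zero) _ _ (≤-trans ge (+-monoˡ-≤ _ (le zero)))) i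

-- The label `q` is identified with `p` and the rest renumbered without a gap, so each merge lowers
-- the number of labels by exactly one; `forest-bound` counts merges in this way.
merge : ∀ {m} {p q : Fin (suc m)} → q ≢ p → Fin (suc m) → Fin m
merge {q = q} q≢p x with q Fin.≟ x
... | yes _  = punchOut q≢p
... | no q≢x = punchOut q≢x

merge-kernel : ∀ {m} {p q : Fin (suc m)} (q≢p : q ≢ p) x y → merge q≢p x ≡ merge q≢p y →
               x ≡ y ⊎ (x ≡ p × y ≡ q) ⊎ (x ≡ q × y ≡ p)
merge-kernel {q = q} q≢p x y eq with q Fin.≟ x | q Fin.≟ y
... | yes refl | yes refl = inj₁ refl
... | yes refl | no q≢y   = inj₂ (inj₂ (refl , sym (punchOut-injective q≢p q≢y eq)))
... | no q≢x   | yes refl = inj₂ (inj₁ (punchOut-injective q≢x q≢p eq , refl))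
... | no q≢x   | no q≢y   = inj₁ (punchOut-injective q≢x q≢y eq)

merge-identifies : ∀ {m} {p q : Fin (suc m)} (q≢p : q ≢ p) → merge q≢p q ≡ merge q≢p p
merge-identifies {p = p} {q} q≢p with q Fin.≟ q | q Fin.≟ p
... | yes _  | yes q≡p = ⊥-elim (q≢p q≡p)
... | yes _  | no q≢p′ = punchOut-cong q refl
... | no q≢q | _       = ⊥-elim (q≢q refl)

merge-punchIn : ∀ {m} {p q : Fin (suc m)} (q≢p : q ≢ p) z → merge q≢p (punchIn q z) ≡ z
merge-punchIn {q = q} q≢p z with q Fin.≟ punchIn q z
... | yes q≡  = ⊥-elim (punchInᵢ≢i q z (sym q≡))
... | no  q≢  = trans (punchOut-cong q refl) (punchOut-punchIn q)

-- Walks and components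

module InGraph (G : Graph) where

  V E : Set
  V = Fin (nV G)
  E = Fin (nE G)

  src tgt : E → V
  src e = proj₁ (ends G e)
  tgt e = proj₂ (ends G e)

  joins-ends : ∀ e → Joins G e (src e) (tgt e)
  joins-ends e = inj₁ refl

  infixr 5 _⧺_
  _⧺_ : ∀ {u v w} → Walk G u v → Walk G v w → Walk G u w
  nil        ⧺ q = q
  cons e j p ⧺ q = cons e j (p ⧺ q)

  edges-⧺ : ∀ {u v w} (p : Walk G u v) (q : Walk G v w) → walkEdges (p ⧺ q) ≡ walkEdges p ++ walkEdges q
  edges-⧺ nil          q = refl
  edges-⧺ (cons e _ p) q = cong (e ∷_) (edges-⧺ p q)

  rev : ∀ {u v} → Walk G u v → Walk G v u
  rev nil          = nil
  rev (cons e j p) = rev p ⧺ cons e (swap j) nil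

  All-⧺ : ∀ {P : E → Set} {u v w} (p : Walk G u v) (q : Walk G v w) →
          All P (walkEdges p) → All P (walkEdges q) → All P (walkEdges (p ⧺ q))
  All-⧺ p q ps qs = subst (All _) (sym (edges-⧺ p q)) (Allₚ.++⁺ ps qs)

  All-rev : ∀ {P : E → Set} {u v} (p : Walk G u v) → All P (walkEdges p) → All P (walkEdges (rev p))
  All-rev nil          []       = []
  All-rev (cons e j p) (x ∷ xs) = All-⧺ (rev p) _ (All-rev p xs) (x ∷ [])

  edges-⧺⁻ : ∀ {u v w f} (p : Walk G u v) (q : Walk G v w) → f ∈ walkEdges (p ⧺ q) → f ∈ walkEdges p ⊎ f ∈ walkEdges q
  edges-⧺⁻ p q = All.lookup (All-⧺ p q (All.tabulate inj₁) (All.tabulate inj₂))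

  edges-rev⁻ : ∀ {u v f} (p : Walk G u v) → f ∈ walkEdges (rev p) → f ∈ walkEdges p
  edges-rev⁻ p = All.lookup (All-rev p (All.tabulate id))

  start∈ : ∀ {u v} (p : Walk G u v) → u ∈ walkVertices p
  start∈ nil          = here refl
  start∈ (cons _ _ _) = here refl

  end∈ : ∀ {u v} (p : Walk G u v) → v ∈ walkVertices p
  end∈ nil          = here refl
  end∈ (cons _ _ p) = there (end∈ p)

  ∈-⧺ˡ : ∀ {u v w x} (p : Walk G u v) (q : Walk G v w) → x ∈ walkVertices p → x ∈ walkVertices (p ⧺ q)
  ∈-⧺ˡ nil          q (here refl) = start∈ q
  ∈-⧺ˡ (cons _ _ p) q (here refl) = here refl
  ∈-⧺ˡ (cons _ _ p) q (there x∈)  = there (∈-⧺ˡ p q x∈)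

  ∈-⧺ʳ : ∀ {u v w x} (p : Walk G u v) (q : Walk G v w) → x ∈ walkVertices q → x ∈ walkVertices (p ⧺ q)
  ∈-⧺ʳ nil          q x∈ = x∈
  ∈-⧺ʳ (cons _ _ p) q x∈ = there (∈-⧺ʳ p q x∈)

  ∈-⧺⁻ : ∀ {u v w x} (p : Walk G u v) (q : Walk G v w) →
         x ∈ walkVertices (p ⧺ q) → x ∈ walkVertices p ⊎ x ∈ walkVertices q
  ∈-⧺⁻ nil          q x∈          = inj₂ x∈
  ∈-⧺⁻ (cons _ _ p) q (here refl) = inj₁ (here refl)
  ∈-⧺⁻ (cons _ _ p) q (there x∈) with ∈-⧺⁻ p q x∈
  ... | inj₁ x∈p = inj₁ (there x∈p)
  ... | inj₂ x∈q = inj₂ x∈q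

  splitAt : ∀ {u v x} (p : Walk G u v) → x ∈ walkVertices p →
            Σ (Walk G u x) λ p₁ → Σ (Walk G x v) λ p₂ → p ≡ p₁ ⧺ p₂
  splitAt nil          (here refl) = nil , nil , refl
  splitAt (cons e j p) (here refl) = nil , cons e j p , refl
  splitAt (cons e j p) (there x∈) with p₁ , p₂ , refl ← splitAt p x∈ = cons e j p₁ , p₂ , refl

  edge-ends∈ : ∀ {u v e a b} (p : Walk G u v) → e ∈ walkEdges p → Joins G e a b → a ∈ walkVertices p × b ∈ walkVertices p
  edge-ends∈ (cons e (inj₁ j) p) (here refl) (inj₁ k) with refl ← trans (sym j) k = here refl , there (start∈ p)
  edge-ends∈ (cons e (inj₁ j) p) (here refl) (inj₂ k) with refl ← trans (sym j) k = there (start∈ p) , here refl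
  edge-ends∈ (cons e (inj₂ j) p) (here refl) (inj₁ k) with refl ← trans (sym j) k = there (start∈ p) , here refl
  edge-ends∈ (cons e (inj₂ j) p) (here refl) (inj₂ k) with refl ← trans (sym j) k = here refl , there (start∈ p)
  edge-ends∈ (cons e _ p) (there e∈) j with a∈ , b∈ ← edge-ends∈ p e∈ j = there a∈ , there b∈

  path-edges-unique : ∀ {u v} (p : Walk G u v) → IsPath p → Unique (walkEdges p)
  path-edges-unique nil          _        = []
  path-edges-unique (cons e j p) (u∉ ∷ u) =
    All.tabulate (λ f∈ e≡f → All.lookup u∉ (proj₁ (edge-ends∈ p (subst (_∈ _) (sym e≡f) f∈) j)) refl) ∷ path-edges-unique p u

  suffix-path : ∀ {u v w} (p : Walk G u v) (q : Walk G v w) → IsPath (p ⧺ q) → IsPath q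
  suffix-path nil          q u       = u
  suffix-path (cons _ _ p) q (_ ∷ u) = suffix-path p q u

  open import Data.List.Membership.DecPropositional (Fin._≟_ {nV G}) using () renaming (_∈?_ to _∈ᵛ?_) public
  open import Data.List.Membership.DecPropositional (Fin._≟_ {nE G}) using () renaming (_∈?_ to _∈ᵉ?_) public

  shorten : ∀ {u v} (p : Walk G u v) → Σ (Walk G u v) λ q → IsPath q × (∀ {e} → e ∈ walkEdges q → e ∈ walkEdges p)
  shorten nil = nil , [] ∷ [] , id
  shorten {u} (cons e j p) with shorten p
  ... | q , path , sub with u ∈ᵛ? walkVertices q
  ...   | no u∉ = cons e j q , Allₚ.¬Any⇒All¬ _ u∉ ∷ path , λ { (here refl) → here refl ; (there f∈) → there (sub f∈) }
  ...   | yes u∈ with q₁ , q₂ , refl ← splitAt q u∈ =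
    q₂ , suffix-path q₁ q₂ path , λ f∈ → there (sub (subst (_ ∈_) (sym (edges-⧺ q₁ q₂)) (∈-++⁺ʳ (walkEdges q₁) f∈)))

  Linked : (E → Set) → V → V → Set
  Linked P u v = Σ (Walk G u v) (All P ∘ walkEdges)

  module _ {P : E → Set} where

    linked-refl : ∀ {u} → Linked P u u
    linked-refl = nil , []

    linked-trans : ∀ {u v w} → Linked P u v → Linked P v w → Linked P u w
    linked-trans (p , ps) (q , qs) = p ⧺ q , All-⧺ p q ps qs

    linked-sym : ∀ {u v} → Linked P u v → Linked P v u
    linked-sym (p , ps) = rev p , All-rev p ps

    linked-edge : ∀ {e u v} → P e → Joins G e u v → Linked P u v
    linked-edge pe j = cons _ j nil , pe ∷ []

    linked-map : ∀ {Q : E → Set} → (∀ {e} → P e → Q e) → ∀ {u v} → Linked P u v → Linked Q u v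
    linked-map f (p , ps) = p , All.map f ps

  linked-bind : ∀ {P Q : E → Set} → (∀ {e} → P e → Linked Q (src e) (tgt e)) → ∀ {u v} → Linked P u v → Linked Q u v
  linked-bind f (nil , []) = linked-refl
  linked-bind f (cons e (inj₁ refl) p , pe ∷ ps) = linked-trans (f pe) (linked-bind f (p , ps))
  linked-bind f (cons e (inj₂ refl) p , pe ∷ ps) = linked-trans (linked-sym (f pe)) (linked-bind f (p , ps))

  module _ {m} {ℓ : V → Fin (suc m)} {P Q : E → Set} (sound : ∀ {u v} → ℓ u ≡ ℓ v → Linked P u v)
           (P⊆Q : ∀ {e} → P e → Q e) {e} (Qe : Q e) (s≢t : ℓ (src e) ≢ ℓ (tgt e)) where

    merge-sound : ∀ {u v} → merge s≢t (ℓ u) ≡ merge s≢t (ℓ v) → Linked Q u v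
    merge-sound {u} {v} eq with merge-kernel s≢t (ℓ u) (ℓ v) eq
    ... | inj₁ same               = linked-map P⊆Q (sound same)
    ... | inj₂ (inj₁ (u~t , v~s)) = linked-trans (linked-map P⊆Q (sound u~t))
                                      (linked-trans (linked-edge Qe (swap (joins-ends e))) (linked-map P⊆Q (sound (sym v~s))))
    ... | inj₂ (inj₂ (u~s , v~t)) = linked-trans (linked-map P⊆Q (sound u~s))
                                      (linked-trans (linked-edge Qe (joins-ends e)) (linked-map P⊆Q (sound (sym v~t))))

  -- `rep` and `label-rep` make `label` surjective: the boundary count needs a vertex in each of the
  -- `size` components, from which to take a cut.
  record Components (P : E → Set) : Set where
    field
      size      : ℕ
      label     : V → Fin size
      rep       : Fin size → V
      label-rep : ∀ i → label (rep i) ≡ i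
      sound     : ∀ {u v} → label u ≡ label v → Linked P u v
      preserved : ∀ {e} → P e → label (src e) ≡ label (tgt e)

    complete : ∀ {u v} → Linked P u v → label u ≡ label v
    complete (nil , []) = refl
    complete (cons e (inj₁ refl) p , pe ∷ ps) = trans (preserved pe) (complete (p , ps))
    complete (cons e (inj₂ refl) p , pe ∷ ps) = trans (sym (preserved pe)) (complete (p , ps))

  list-components : ∀ es → Components (_∈ es)
  list-components [] = record
    { size = nV G ; label = id ; rep = id ; label-rep = λ _ → refl ; sound = λ { refl → linked-refl } ; preserved = λ () }
  list-components (e ∷ es) = go (list-components es)
    where
    go : Components (_∈ es) → Components (_∈ (e ∷ es))
    go c with Components.label c (src e) Fin.≟ Components.label c (tgt e)
    ... | yes s≡t = record
      { Components c ; sound = linked-map there ∘ Components.sound c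
      ; preserved = λ { (here refl) → s≡t ; (there e∈) → Components.preserved c e∈ } }
    go record { size = suc m ; label = ℓ ; rep = rep ; label-rep = label-rep ; sound = sound ; preserved = preserved } | no s≢t = record
      { size = m ; label = merge s≢t ∘ ℓ ; rep = rep ∘ punchIn (ℓ (src e))
      ; label-rep = λ i → trans (cong (merge s≢t) (label-rep _)) (merge-punchIn s≢t i)
      ; sound = merge-sound sound there (here refl) s≢t
      ; preserved = λ { (here refl) → merge-identifies s≢t ; (there e∈) → cong (merge s≢t) (preserved e∈) } }
    go record { size = zero ; label = ℓ } | no s≢t with () ← ℓ (src e)

  components : ∀ {P : E → Set} → Decidable P → Components P
  components P? = record
    { Components c
    ; sound = linked-map (λ e∈ → proj₂ (∈-filter⁻ P? {xs = allFin _} e∈)) ∘ Components.sound c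
    ; preserved = λ pe → Components.preserved c (∈-filter⁺ P? (∈-allFin _) pe) }
    where c = list-components (filter P? (allFin (nE G)))

  linked? : ∀ {P : E → Set} → Decidable P → ∀ u v → Dec (Linked P u v)
  linked? P? u v = map′ (Components.sound c) (Components.complete c) (Components.label c u Fin.≟ Components.label c v)
    where c = components P?

  -- The edges are inserted one at a time, `P` collecting those already present. An edge with
  -- equally labelled ends would be bypassed, so every insertion merges two labels, and `m` labels
  -- allow at most `m - 1` merges.
  forest-bound : ∀ {m} (ℓ : V → Fin m) (P : E → Set) → (∀ {u v} → ℓ u ≡ ℓ v → Linked P u v) → V →
    ∀ es → Unique es → (∀ {e} → e ∈ es → ¬ Linked (λ f → P f ⊎ (f ∈ es × e ≢ f)) (src e) (tgt e)) → length es < m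
  forest-bound {zero}  ℓ P sound v es _ _ with () ← ℓ v
  forest-bound {suc m} ℓ P sound v [] _ _ = s≤s z≤n
  forest-bound {suc m} ℓ P sound v (e ∷ es) (e∉ ∷ u) bridge = s≤s
    (forest-bound (merge s≢t ∘ ℓ) (λ f → P f ⊎ e ≡ f) (merge-sound sound inj₁ (inj₂ refl) s≢t) v es u
      λ f∈ linked → bridge (there f∈) (linked-map
        (λ { (inj₁ (inj₁ p)) → inj₁ p ; (inj₁ (inj₂ refl)) → inj₂ (here refl , All.lookup e∉ f∈ ∘ sym)
           ; (inj₂ (g∈ , f≢g)) → inj₂ (there g∈ , f≢g) }) linked))
    where
    s≢t : ℓ (src e) ≢ ℓ (tgt e)
    s≢t eq = bridge (here refl) (linked-map inj₁ (sound eq))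

-- Packing connected spanning classes

argmax : ∀ {k} (f : Fin (suc k) → ℕ) → ∃ λ i → ∀ j → f j ≤ f i
argmax {zero}  f = zero , λ { zero → ≤-refl }
argmax {suc k} f with argmax (f ∘ suc)
... | i , max with ≤-total (f zero) (f (suc i))
...   | inj₁ le = suc i , λ { zero → le ; (suc j) → max j }
...   | inj₂ ge = zero , λ { zero → ≤-refl ; (suc j) → ≤-trans (max j) ge }

argmaxVec : ∀ {k n} (f : Vec (Fin (suc k)) n → ℕ) → ∃ λ c → ∀ c′ → f c′ ≤ f c
argmaxVec {n = zero}  f = [] , λ { [] → ≤-refl }
argmaxVec {n = suc n} f = go (argmax (λ a → f (a ∷ proj₁ (best a))))
  where
  best : ∀ a → ∃ λ c → ∀ c′ → f (a ∷ c′) ≤ f (a ∷ c)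
  best a = argmaxVec (f ∘ (a ∷_))
  go : (∃ λ a → ∀ b → f (b ∷ proj₁ (best b)) ≤ f (a ∷ proj₁ (best a))) → ∃ λ c → ∀ c′ → f c′ ≤ f c
  go (a , max) = a ∷ proj₁ (best a) , λ { (b ∷ c′) → ≤-trans (proj₂ (best b) c′) (max b) }

¬¬-decidable : ∀ {n} (P : Fin n → Set) → ¬ ¬ Decidable P
¬¬-decidable {zero}  P k = k λ ()
¬¬-decidable {suc n} P k = ¬¬-excluded-middle λ d → ¬¬-decidable (P ∘ suc) λ ds → k λ { zero → d ; (suc i) → ds i }

term≤sum : ∀ {n} (f : Fin n → ℕ) i → f i ≤ sum f
term≤sum f zero    = m≤m+n _ _
term≤sum f (suc i) = ≤-trans (term≤sum (f ∘ suc) i) (m≤n+m _ _)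

sum-𝟙-none : ∀ {n} {P : Fin n → Set} (P? : Decidable P) → (∀ i → ¬ P i) → sum (λ i → 𝟙 (P? i)) ≡ 0
sum-𝟙-none {zero}  P? none = refl
sum-𝟙-none {suc n} P? none with P? zero
... | yes p = ⊥-elim (none zero p)
... | no  _ = sum-𝟙-none (P? ∘ suc) (none ∘ suc)

sum-𝟙-≤1 : ∀ {n} {P : Fin n → Set} (P? : Decidable P) → (∀ {i j} → P i → P j → i ≡ j) → sum (λ i → 𝟙 (P? i)) ≤ 1
sum-𝟙-≤1 {zero}  P? unique = z≤n
sum-𝟙-≤1 {suc n} P? unique with P? zero
... | yes p = ≤-reflexive (cong suc (sum-𝟙-none (P? ∘ suc) λ i q → Finₚ.0≢1+n (unique p q)))
... | no  _ = sum-𝟙-≤1 (P? ∘ suc) λ p q → Finₚ.suc-injective (unique p q)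

module Packing (G : Graph) where
  open InGraph G

  cut-bound : ∀ {K} {P : E → Set} (P? : Decidable P) → EdgeConnected K G →
    ∀ {u v} → ¬ Linked (¬_ ∘ P) u v → K ≤ sum (λ e → 𝟙 (P? e))
  cut-bound {K} {P} P? conn {u} {v} sep = ≮⇒≥ λ small →
    let w , avoids = conn F (subst (_< K) (sym (∣tabulate∣ P?)) small) u v
    in sep (w , All.map (λ e∉ pe → e∉ (lookup⇒[]= _ F (trans (lookup∘tabulate (does ∘ P?) _) (dec-true (P? _) pe)))) avoids)
    where
    F : Subset (nE G)
    F = Vec.tabulate (does ∘ P?)

  linked-ends : ∀ {P f a b} → Joins G f a b → Linked P a b → Linked P (src f) (tgt f)
  linked-ends (inj₁ refl) l = l
  linked-ends (inj₂ refl) l = linked-sym l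

  -- This is the exchange step: if `w` joins the ends of another edge `e`, then `e` and the two
  -- pieces of `w` around `f` link the ends of `f`. The pieces avoid `f` because `w` uses it only
  -- once.
  bypass : ∀ {f u v} (w : Walk G u v) → Unique (walkEdges w) → f ∈ walkEdges w →
    let R = λ g → g ∈ walkEdges w × f ≢ g in
    ∃ λ a → ∃ λ b → Joins G f a b × Linked R u a × Linked R b v
  bypass (cons f j w) (f∉ ∷ u) (here refl) =
    _ , _ , j , linked-refl , (w , All.tabulate λ g∈ → there g∈ , All.lookup f∉ g∈)
  bypass {f} (cons e j w) (e∉ ∷ u) (there f∈) with a , b , jf , l , r ← bypass w u f∈
    = a , b , jf , linked-trans (linked-edge (here refl , All.lookup e∉ f∈ ∘ sym) j) (linked-map lift l) , linked-map lift r
    where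
    lift : ∀ {g} → g ∈ walkEdges w × f ≢ g → g ∈ e ∷ walkEdges w × f ≢ g
    lift (g∈ , f≢g) = there g∈ , f≢g

  module _ {k : ℕ} where

    Colouring : Set
    Colouring = Vec (Fin (suc k)) (nE G)

    Class : Colouring → Fin (suc k) → E → Set
    Class c i e = Vec.lookup c e ≡ i

    class? : ∀ c i → Decidable (Class c i)
    class? c i e = Vec.lookup c e Fin.≟ i

    Optimal : Colouring → Set
    Optimal c = ∀ c′ → (∀ i u v → Linked (Class c i) u v → Linked (Class c′ i) u v) →
                ∀ i u v → Linked (Class c′ i) u v → Linked (Class c i) u v

    -- The maximised quantity is the number of linked triples `(i, u, v)`. If `c′` keeps every
    -- linking of `c`, each indicator can only grow, and maximality of the total forbids any growth.
    exists-optimal : ∃ Optimal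
    exists-optimal with c , max ← argmaxVec (λ c → sum λ i → sum λ u → sum λ v → 𝟙 (linked? (class? c i) u v))
      = c , λ c′ sub i u v → 𝟙-reflects-≤ (linked? (class? c′ i) u v) (linked? (class? c i) u v)
          (sum-squeeze (le c′ sub i u) (sum-squeeze (λ u → sum-mono-≤ (le c′ sub i u))
            (sum-squeeze (λ i → sum-mono-≤ λ u → sum-mono-≤ (le c′ sub i u)) (max c′) i) u) v)
      where
      le : ∀ c′ (sub : ∀ i u v → Linked (Class c i) u v → Linked (Class c′ i) u v) i u v →
           𝟙 (linked? (class? c i) u v) ≤ 𝟙 (linked? (class? c′ i) u v)
      le c′ sub i u v = 𝟙-mono (linked? (class? c i) u v) (linked? (class? c′ i) u v) (sub i u v)

    Redundant : Colouring → E → Set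
    Redundant c e = Linked (λ f → Class c (Vec.lookup c e) f × e ≢ f) (src e) (tgt e)

    recolour-linked : ∀ {c e} → Redundant c e → ∀ j i {u v} → Linked (Class c i) u v → Linked (Class (c [ e ]≔ j) i) u v
    recolour-linked {c} {e} red j i = linked-bind λ {f} → step f
      where
      step : ∀ f → Class c i f → Linked (Class (c [ e ]≔ j) i) (src f) (tgt f)
      step f refl with e Fin.≟ f
      ... | yes refl = linked-map (λ (eq , e≢) → trans (lookup∘update′ (e≢ ∘ sym) c j) eq) red
      ... | no  e≢f  = linked-edge (lookup∘update′ (e≢f ∘ sym) c j) (joins-ends f)

    data Reachable (c₀ : Colouring) : Colouring → Set where
      start : Reachable c₀ c₀
      move  : ∀ {c e} → Reachable c₀ c → Redundant c e → ∀ j → Reachable c₀ (c [ e ]≔ j)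

    reachable-linked : ∀ {c₀ c} → Reachable c₀ c → ∀ i u v → Linked (Class c₀ i) u v → Linked (Class c i) u v
    reachable-linked start          i u v = id
    reachable-linked (move {c} ρ red j) i u v = recolour-linked {c} red j i ∘ reachable-linked ρ i u v

    module _ (c₀ : Colouring) (opt : Optimal c₀) where

      -- Optimality makes every recolouring of a redundant edge preserve all the linkings, so the ends of
      -- a free edge are linked by free edges in every class (free-linked). The remaining edges of a class
      -- form a forest over the components of the free edges, so if there are m ≥ 2 components, fewer than
      -- (k + 1) m edges run between them, against the (k + 1) m forced by edge-connectivity.
      Free : E → Set
      Free e = ∃ λ c → Reachable c₀ c × Redundant c e

      -- All reachable colourings have the same linkings: recolouring a redundant edge loses none,
      -- and by optimality of `c₀` none is gained.
      linked-back : ∀ {c c′} → Reachable c₀ c → Reachable c₀ c′ → ∀ {i u v} → Linked (Class c′ i) u v → Linked (Class c i) u v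
      linked-back {c′ = c′} ρ ρ′ {i} {u} {v} = reachable-linked ρ i u v ∘ opt c′ (reachable-linked ρ′) i u v

      -- Recolouring `e` with `j` creates no linking, so the ends of `e` are already linked in class
      -- `j` without `e`. On a path realising this, each edge becomes redundant once `e` joins the
      -- class, as `e` closes the path to a cycle; hence each of them is free.
      free-linked-at : ∀ {c e} → Reachable c₀ c → Redundant c e → ∀ j → Linked (λ f → Class c j f × Free f) (src e) (tgt e)
      free-linked-at {c} {e} ρ red j = go around
        where
        c′ = c [ e ]≔ j
        around : Linked (λ f → Class c j f × e ≢ f) (src e) (tgt e)
        around with Vec.lookup c e Fin.≟ j
        ... | yes refl = red
        ... | no  ce≢j = linked-map (λ cf≡j → cf≡j , λ { refl → ce≢j cf≡j })
                           (linked-back ρ (move ρ red j) (linked-edge (lookup∘update e c j) (joins-ends e)))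
        go : Linked (λ f → Class c j f × e ≢ f) (src e) (tgt e) → _
        go (w , ws) with p , path , sub ← shorten w = p , All.tabulate λ f∈ → proj₁ (on f∈) , c′ , move ρ red j , redundant f∈
          where
          on : ∀ {f} → f ∈ walkEdges p → Class c j f × e ≢ f
          on f∈ = All.lookup ws (sub f∈)
          new : ∀ {f} → f ∈ walkEdges p → Class c′ j f
          new f∈ = trans (lookup∘update′ (proj₂ (on f∈) ∘ sym) c j) (proj₁ (on f∈))
          redundant : ∀ {f} → f ∈ walkEdges p → Redundant c′ f
          redundant {f} f∈ with a , b , jf , l , r ← bypass p (path-edges-unique p path) f∈
            = linked-ends jf (linked-trans (linked-sym (linked-map lift l))
                (linked-trans (linked-edge (trans (lookup∘update e c j) (sym (new f∈)) , proj₂ (on f∈) ∘ sym) (joins-ends e))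
                  (linked-sym (linked-map lift r))))
            where
            lift : ∀ {g} → g ∈ walkEdges p × f ≢ g → Class c′ (Vec.lookup c′ f) g × f ≢ g
            lift (g∈ , f≢g) = trans (new g∈) (sym (new f∈)) , f≢g

      -- The moves are undone one by one. Only the moved edge `e` changes class, and
      -- `free-linked-at`, applied before the move, replaces it by free edges of its new class. This
      -- works because `Free` does not depend on the current colouring.
      pull-back : ∀ {c} → Reachable c₀ c → ∀ {i u v} →
        Linked (λ f → Class c i f × Free f) u v → Linked (λ f → Class c₀ i f × Free f) u v
      pull-back start = id
      pull-back (move {c} {e} ρ red j) {i} = pull-back ρ ∘ linked-bind λ {f} → step f
        where
        step : ∀ f → Class (c [ e ]≔ j) i f × Free f → Linked (λ f → Class c i f × Free f) (src f) (tgt f)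
        step f (eq , free) with e Fin.≟ f
        ... | no e≢f   = linked-edge (trans (sym (lookup∘update′ (e≢f ∘ sym) c j)) eq , free) (joins-ends f)
        ... | yes refl = subst (λ i → Linked (λ f → Class c i f × Free f) _ _) (trans (sym (lookup∘update e c j)) eq)
                           (free-linked-at ρ red j)

      free-linked : ∀ {e} → Free e → ∀ i → Linked (λ f → Class c₀ i f × Free f) (src e) (tgt e)
      free-linked (c , ρ , red) i = pull-back ρ (free-linked-at ρ red i)

      module _ (conn : EdgeConnected (2 * suc k) G) (free? : Decidable Free) where
        open Components (components free?)

        Boundary : Fin size → E → Set
        Boundary z e = (label (src e) ≡ z × label (tgt e) ≢ z) ⊎ (label (tgt e) ≡ z × label (src e) ≢ z)

        boundary? : ∀ z → Decidable (Boundary z)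
        boundary? z e = ((label (src e) Fin.≟ z) ×-dec ¬? (label (tgt e) Fin.≟ z)) ⊎-dec
                        ((label (tgt e) Fin.≟ z) ×-dec ¬? (label (src e) Fin.≟ z))

        stays-inside : ∀ {z u v} → Linked (¬_ ∘ Boundary z) u v → label u ≡ z → label v ≡ z
        stays-inside (nil , []) eq = eq
        stays-inside {z} (cons e (inj₁ refl) w , out ∷ ws) eq = stays-inside (w , ws)
          (decidable-stable (_ Fin.≟ z) λ ≢z → out (inj₁ (eq , ≢z)))
        stays-inside {z} (cons e (inj₂ refl) w , out ∷ ws) eq = stays-inside (w , ws)
          (decidable-stable (_ Fin.≟ z) λ ≢z → out (inj₂ (eq , ≢z)))

        bound? : ∀ i → Decidable (λ e → ¬ Free e × Class c₀ i e)
        bound? i e = ¬? (free? e) ×-dec class? c₀ i e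

        -- A free edge has equally labelled ends and crosses no boundary. Any other edge lies in at
        -- most two boundaries, one per end, and is counted in its own class; this is the factor 2
        -- in the required connectivity.
        boundaries-≤ : ∀ e → sum (λ z → 𝟙 (boundary? z e)) ≤ 2 * sum (λ i → 𝟙 (bound? i e))
        boundaries-≤ e with free? e
        ... | yes free = ≤-trans (≤-reflexive (sum-𝟙-none (λ z → boundary? z e)
            λ { z (inj₁ (s , t)) → t (trans (sym (preserved free)) s) ; z (inj₂ (t , s)) → s (trans (preserved free) t) })) z≤n
        ... | no bound = ≤-trans (≤-trans (sum-mono-≤ split)
            (≤-reflexive (∑-distrib-+ (λ z → 𝟙 (label (src e) Fin.≟ z)) (λ z → 𝟙 (label (tgt e) Fin.≟ z)))))
            (≤-trans (+-mono-≤ (sum-𝟙-≤1 (label (src e) Fin.≟_) (λ p q → trans (sym p) q))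
                               (sum-𝟙-≤1 (label (tgt e) Fin.≟_) (λ p q → trans (sym p) q)))
              (*-monoʳ-≤ 2 (≤-trans one (term≤sum (λ i → 𝟙 (¬? (no bound) ×-dec class? c₀ i e)) (Vec.lookup c₀ e)))))
          where
          one : 1 ≤ 𝟙 (¬? (no bound) ×-dec class? c₀ (Vec.lookup c₀ e) e)
          one = 𝟙-mono (yes refl) (¬? (no bound) ×-dec class? c₀ (Vec.lookup c₀ e) e) (λ (_ : 0 ≡ 0) → bound , refl)
          split : ∀ z → 𝟙 (boundary? z e) ≤ 𝟙 (label (src e) Fin.≟ z) + 𝟙 (label (tgt e) Fin.≟ z)
          split z with label (src e) Fin.≟ z | label (tgt e) Fin.≟ z
          ... | yes _ | yes _ = z≤n
          ... | yes _ | no  _ = ≤-refl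
          ... | no  _ | yes _ = ≤-refl
          ... | no  _ | no  _ = z≤n

        -- Equally labelled vertices are linked by free edges within class `i`. A bound edge
        -- bypassed by these and other bound edges of its class would be redundant in `c₀`, hence
        -- free; so `forest-bound` applies.
        bound-count : ∀ i → V → sum (λ e → 𝟙 (bound? i e)) < size
        bound-count i v = subst (_< size) (length-filter-tabulate (bound? i) id)
          (forest-bound label (λ f → Class c₀ i f × Free f) (linked-bind (λ free → free-linked free i) ∘ sound) v
            es (Uniqueₚ.filter⁺ (bound? i) (Uniqueₚ.allFin⁺ _)) bridge)
          where
          es = filter (bound? i) (allFin (nE G))
          bridge : ∀ {e} → e ∈ es → ¬ Linked (λ f → (Class c₀ i f × Free f) ⊎ (f ∈ es × e ≢ f)) (src e) (tgt e)
          bridge e∈ l with _ , ¬free , refl ← ∈-filter⁻ (bound? i) {xs = allFin _} e∈ = ¬free (c₀ , start , linked-map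
            (λ { (inj₁ (cf , free)) → cf , (λ { refl → ¬free free })
               ; (inj₂ (f∈ , e≢f)) → proj₂ (proj₂ (∈-filter⁻ (bound? i) {xs = allFin _} f∈)) , e≢f }) l)

        connected-label : ∀ u v → label u ≡ label v
        connected-label u v with label u Fin.≟ label v
        ... | yes eq = eq
        ... | no  ne = ⊥-elim (<-irrefl refl (begin-strict
          size * (2 * suc k)                                      ≡⟨ sym (sum-const size _) ⟩
          sum {size} (λ _ → 2 * suc k)                            ≤⟨ sum-mono-≤ large-boundary ⟩
          sum (λ z → sum λ e → 𝟙 (boundary? z e))                 ≡⟨ ∑-comm (λ z e → 𝟙 (boundary? z e)) ⟩
          sum (λ e → sum λ z → 𝟙 (boundary? z e))                 ≤⟨ sum-mono-≤ boundaries-≤ ⟩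
          sum (λ e → 2 * sum λ i → 𝟙 (bound? i e))                ≡⟨ ∑-distrib-2* (λ e → sum λ i → 𝟙 (bound? i e)) ⟩
          2 * sum (λ e → sum λ i → 𝟙 (bound? i e))                ≡⟨ cong (2 *_) (∑-comm (λ e i → 𝟙 (bound? i e))) ⟩
          2 * sum (λ i → sum λ e → 𝟙 (bound? i e))                <⟨ *-monoʳ-< 2 (+-mono-<-≤ (bound-count zero u)
                                                                       (sum-mono-≤ λ i → <⇒≤ (bound-count (suc i) u))) ⟩
          2 * sum {suc k} (λ _ → size)                            ≡⟨ cong (2 *_) (sum-const (suc k) size) ⟩
          2 * (suc k * size)                                      ≡⟨ sym (*-assoc 2 (suc k) size) ⟩
          2 * suc k * size                                        ≡⟨ *-comm (2 * suc k) size ⟩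
          size * (2 * suc k)                                      ∎))
          where
          open ≤-Reasoning
          ∑-distrib-2* : ∀ {n} (f : Fin n → ℕ) → sum (λ i → 2 * f i) ≡ 2 * sum f
          ∑-distrib-2* {zero}  f = refl
          ∑-distrib-2* {suc n} f = trans (cong (2 * f zero +_) (∑-distrib-2* (f ∘ suc))) (sym (*-distribˡ-+ 2 (f zero) _))
          large-boundary : ∀ z → 2 * suc k ≤ sum (λ e → 𝟙 (boundary? z e))
          -- Each component misses some vertex: `v` if it contains `u`, and otherwise `u`.
          large-boundary z with label u Fin.≟ z
          ... | yes refl = cut-bound (boundary? z) conn λ l → ne (sym (stays-inside {u = u} {v} l refl))
          ... | no  u≢z  = cut-bound (boundary? z) conn λ l → u≢z (stays-inside {u = rep z} {u} l (label-rep z))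

    -- Free quantifies over reachable colourings; linking is decidable, so Free may be decided under ¬¬.
    packing : EdgeConnected (2 * suc k) G → ∃ λ c → ∀ i u v → Linked (Class c i) u v
    packing conn with c₀ , opt ← exists-optimal = c₀ , λ i u v →
      decidable-stable (linked? (class? c₀ i) u v) λ ¬l → ¬¬-decidable (Free c₀ opt) λ free? →
        ¬l (linked-map proj₁ (linked-bind (λ free → free-linked c₀ opt free i)
          (Components.sound (components free?) (connected-label c₀ opt conn free? u v))))

-- Even edge sets and closed trails

xor-cancel-middle : ∀ a b c → (a xor b) xor (b xor c) ≡ a xor c
xor-cancel-middle false false c = refl
xor-cancel-middle false true  false = refl
xor-cancel-middle false true  true = refl
xor-cancel-middle true  false c = refl
xor-cancel-middle true  true  c = refl

⨁-true : ∀ {n} (f : Fin n → Bool) → ⨁ f ≡ true → ∃ λ i → f i ≡ true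
⨁-true {suc n} f eq with f zero in fz
... | true  = zero , fz
... | false with i , fi ← ⨁-true (f ∘ suc) eq = suc i , fi

⨁-false : ∀ {n} {f : Fin n → Bool} → (∀ i → f i ≡ false) → ⨁ f ≡ false
⨁-false {zero}  none = refl
⨁-false {suc n} none rewrite none zero = ⨁-false (none ∘ suc)

⨁-single : ∀ {n} (i : Fin n) (f : Fin n → Bool) → ⨁ (λ j → does (i Fin.≟ j) ∧ f j) ≡ f i
⨁-single {suc n} zero    f = trans (cong (f zero xor_) (⨁-false {n} {λ _ → false} λ _ → refl)) (xor-identityʳ (f zero))
⨁-single {suc n} (suc i) f = ⨁-single i (f ∘ suc)

module Parity (G : Graph) where
  open InGraph G

  δ : V → V → Bool
  δ u v = does (u Fin.≟ v)

  EdgeSet : Set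
  EdgeSet = E → Bool

  In : EdgeSet → E → Set
  In X e = X e ≡ true

  -- The edges of odd multiplicity. Walks that repeat edges are allowed: reduced modulo 2, a closed
  -- walk still gives an even set.
  ⟦_⟧ : List E → EdgeSet
  ⟦ [] ⟧     f = false
  ⟦ e ∷ es ⟧ f = does (e Fin.≟ f) xor ⟦ es ⟧ f

  _△_ : EdgeSet → EdgeSet → EdgeSet
  (X △ Y) e = X e xor Y e

  parity : EdgeSet → V → Bool
  parity X v = ⨁ λ e → X e ∧ (δ (src e) v xor δ (tgt e) v)

  Even : EdgeSet → Set
  Even X = ∀ v → parity X v ≡ false

  parity-△ : ∀ X Y v → parity (X △ Y) v ≡ parity X v xor parity Y v
  parity-△ X Y v = trans (⨁-cong λ e → ∧-distribʳ-xor (δ (src e) v xor δ (tgt e) v) (X e) (Y e))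
                         (⨁-distrib-xor (λ e → X e ∧ (δ (src e) v xor δ (tgt e) v)) (λ e → Y e ∧ (δ (src e) v xor δ (tgt e) v)))

  parity-∅ : ∀ v → parity ⟦ [] ⟧ v ≡ false
  parity-∅ v = ⨁-false {nE G} {λ _ → false} λ _ → refl

  parity-edge : ∀ {e a b} → Joins G e a b → ∀ v → parity ⟦ e ∷ [] ⟧ v ≡ δ a v xor δ b v
  parity-edge {e} j v = trans (⨁-cong λ f → cong (_∧ (δ (src f) v xor δ (tgt f) v)) (xor-identityʳ (does (e Fin.≟ f))))
                          (trans (⨁-single e (λ f → δ (src f) v xor δ (tgt f) v)) (orient j))
    where
    orient : ∀ {a b} → Joins G e a b → δ (src e) v xor δ (tgt e) v ≡ δ a v xor δ b v
    orient (inj₁ refl) = refl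
    orient (inj₂ refl) = xor-comm (δ (src e) v) _

  parity-walk : ∀ {a b} (p : Walk G a b) v → parity ⟦ walkEdges p ⟧ v ≡ δ a v xor δ b v
  parity-walk {a} nil v = trans (parity-∅ v) (sym (xor-same (δ a v)))
  parity-walk {a} {b} (cons {w = w} e j p) v = begin
    parity ⟦ e ∷ walkEdges p ⟧ v                           ≡⟨ ⨁-cong (λ f → cong (λ x → (x xor _) ∧ _) (sym (xor-identityʳ (does (e Fin.≟ f))))) ⟩
    parity (⟦ e ∷ [] ⟧ △ ⟦ walkEdges p ⟧) v                 ≡⟨ parity-△ ⟦ e ∷ [] ⟧ ⟦ walkEdges p ⟧ v ⟩
    parity ⟦ e ∷ [] ⟧ v xor parity ⟦ walkEdges p ⟧ v        ≡⟨ cong₂ _xor_ (parity-edge j v) (parity-walk p v) ⟩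
    (δ a v xor δ w v) xor (δ w v xor δ b v)                ≡⟨ xor-cancel-middle (δ a v) (δ w v) (δ b v) ⟩
    δ a v xor δ b v                                        ∎
    where open ≡-Reasoning

  even-△-closed : ∀ {X a} → Even X → (p : Walk G a a) → Even (X △ ⟦ walkEdges p ⟧)
  even-△-closed {X} {a} even p v =
    trans (parity-△ X ⟦ walkEdges p ⟧ v) (trans (cong₂ _xor_ (even v) (parity-walk p v)) (xor-same (δ a v)))

  ∉⇒⟦⟧ : ∀ {e} es → e ∉ es → ⟦ es ⟧ e ≡ false
  ∉⇒⟦⟧     []       _  = refl
  ∉⇒⟦⟧ {e} (f ∷ es) e∉ rewrite dec-false (f Fin.≟ e) (e∉ ∘ here ∘ sym) = ∉⇒⟦⟧ es (e∉ ∘ there)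

  ∈⇒⟦⟧ : ∀ {e es} → Unique es → e ∈ es → In ⟦ es ⟧ e
  ∈⇒⟦⟧ {e} {es = _ ∷ es} (e∉ ∷ u) (here refl) rewrite dec-true (e Fin.≟ e) refl
    | ∉⇒⟦⟧ es (λ e∈ → All.lookup e∉ e∈ refl) = refl
  ∈⇒⟦⟧ {e} {es = f ∷ es} (f∉ ∷ u) (there e∈) rewrite dec-false (f Fin.≟ e) (All.lookup f∉ e∈) = ∈⇒⟦⟧ u e∈

  △-∉ : ∀ {X e} es → e ∉ es → (X △ ⟦ es ⟧) e ≡ X e
  △-∉ {X} {e} es e∉ = trans (cong (X e xor_) (∉⇒⟦⟧ es e∉)) (xor-identityʳ (X e))

  in-difference : ∀ {X es} → Unique es → All (In X) es → ∀ {e} → In (X △ ⟦ es ⟧) e → In X e × e ∉ es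
  in-difference {X} {es} u sub {e} ine = trans (sym (△-∉ {X} es e∉)) ine , e∉
    where
    e∉ : e ∉ es
    e∉ e∈ with () ← trans (sym ine) (cong₂ _xor_ (All.lookup sub e∈) (∈⇒⟦⟧ u e∈))

  size : EdgeSet → ℕ
  size X = sum λ e → 𝟙 (X e Boolₚ.≟ true)

  size-shrinks : ∀ {X Y} → (∀ {e} → In Y e → In X e) → ∀ {e} → In X e → ¬ In Y e → size Y < size X
  size-shrinks {X} {Y} sub {e} x ¬y = ≰⇒> λ ge → ¬y (𝟙-reflects-≤ (X e Boolₚ.≟ true) (Y e Boolₚ.≟ true)
    (sum-squeeze (λ e → 𝟙-mono (Y e Boolₚ.≟ true) (X e Boolₚ.≟ true) sub) ge e) x)

  find-edge : ∀ X v → parity X v ≡ true → ∃ λ e → ∃ λ w → In X e × Joins G e v w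
  find-edge X v odd with e , eq ← ⨁-true _ odd with X e in Xe
  ... | true with src e Fin.≟ v | tgt e Fin.≟ v
  ...   | yes refl | no _     = e , tgt e , Xe , inj₁ refl
  ...   | no _     | yes refl = e , src e , Xe , inj₂ refl

  trail-of-parity : ∀ n X → size X ≤ n → ∀ x y → (∀ v → parity X v ≡ δ x v xor δ y v) →
    Σ (Walk G y x) λ p → Unique (walkEdges p) × All (In X) (walkEdges p)
  trail-of-parity n X size≤ x y odd with x Fin.≟ y
  ... | yes refl = nil , [] , []
  ... | no x≢y with e , w , e∈X , j ← find-edge X y (trans (odd y) (cong₂ _xor_ (dec-false (x Fin.≟ y) x≢y) (dec-true (y Fin.≟ y) refl)))
    = step n size≤
    where
    X′ = X △ ⟦ e ∷ [] ⟧
    smaller : ∀ {f} → In X′ f → In X f × f ∉ e ∷ []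
    smaller = in-difference {X} ([] ∷ []) (e∈X ∷ [])
    shrinks : size X′ < size X
    shrinks = size-shrinks (proj₁ ∘ smaller) e∈X (λ e∈ → proj₂ (smaller e∈) (here refl))
    odd′ : ∀ v → parity X′ v ≡ δ x v xor δ w v
    odd′ v = trans (parity-△ X ⟦ e ∷ [] ⟧ v) (trans (cong₂ _xor_ (odd v) (parity-edge j v)) (xor-cancel-middle (δ x v) (δ y v) (δ w v)))
    step : ∀ n → size X ≤ n → _
    step zero    le with () ← <-≤-trans shrinks le
    step (suc n) le with p , u , ps ← trail-of-parity n X′ (s≤s⁻¹ (<-≤-trans shrinks le)) x w odd′
      = cons e j p , All.map (λ f∈ → λ { refl → proj₂ (smaller f∈) (here refl) }) ps ∷ u , e∈X ∷ All.map (proj₁ ∘ smaller) ps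

  closed-trail-through : ∀ {X e x y} → Even X → In X e → Joins G e x y →
    Σ (Walk G x x) λ p → Unique (walkEdges p) × All (In X) (walkEdges p) × y ∈ walkVertices p
  closed-trail-through {X} {e} {x} {y} even e∈X j =
    let p , u , ps = trail-of-parity _ (X △ ⟦ e ∷ [] ⟧) ≤-refl x y λ v →
                       trans (parity-△ X ⟦ e ∷ [] ⟧ v) (cong₂ _xor_ (even v) (parity-edge j v))
    in cons e j p , All.map (λ f∈ → λ { refl → proj₂ (smaller f∈) (here refl) }) ps ∷ u , e∈X ∷ All.map (proj₁ ∘ smaller) ps , there (start∈ p)
    where
    smaller : ∀ {f} → In (X △ ⟦ e ∷ [] ⟧) f → In X f × f ∉ e ∷ []
    smaller = in-difference {X} ([] ∷ []) (e∈X ∷ [])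

  splice : ∀ {u v X e x y} (w : Walk G u v) → Unique (walkEdges w) → Even X → (∀ {f} → In X f → f ∉ walkEdges w) →
    x ∈ walkVertices w → In X e → Joins G e x y →
    Σ (Walk G u v) λ w′ → Unique (walkEdges w′) × (∀ {f} → f ∈ walkEdges w′ → In X f ⊎ f ∈ walkEdges w) ×
      (∀ {z} → z ∈ walkVertices w → z ∈ walkVertices w′) × y ∈ walkVertices w′
  splice {X = X} w uw even away x∈ e∈X j
    with w₁ , w₂ , refl ← splitAt w x∈ | c , uc , cs , y∈ ← closed-trail-through even e∈X j
    = w₁ ⧺ (c ⧺ w₂) , Permₛ.Unique-resp-↭ (setoid E) (↭⇒↭ₛ (↭-sym perm)) unique
    , (λ f∈ → origin (∈-++⁻ (walkEdges c) (∈-resp-↭ perm f∈)))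
    , (λ z∈ → keep (∈-⧺⁻ w₁ w₂ z∈)) , ∈-⧺ʳ w₁ _ (∈-⧺ˡ c w₂ y∈)
    where
    -- Moving the inserted trail to the front reduces uniqueness to that of two disjoint lists.
    perm : walkEdges (w₁ ⧺ (c ⧺ w₂)) ↭ walkEdges c ++ walkEdges (w₁ ⧺ w₂)
    perm = subst₂ _↭_ (sym (trans (edges-⧺ w₁ _) (cong (walkEdges w₁ ++_) (edges-⧺ c w₂))))
             (cong (walkEdges c ++_) (sym (edges-⧺ w₁ w₂))) (shifts (walkEdges w₁) (walkEdges c))
    unique : Unique (walkEdges c ++ walkEdges (w₁ ⧺ w₂))
    unique = Uniqueₚ.++⁺ uc uw λ (f∈c , f∈w) → away (All.lookup cs f∈c) f∈w
    origin : ∀ {f} → f ∈ walkEdges c ⊎ f ∈ walkEdges (w₁ ⧺ w₂) → In X f ⊎ f ∈ walkEdges (w₁ ⧺ w₂)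
    origin (inj₁ f∈) = inj₁ (All.lookup cs f∈)
    origin (inj₂ f∈) = inj₂ f∈
    keep : ∀ {z} → z ∈ walkVertices w₁ ⊎ z ∈ walkVertices w₂ → z ∈ walkVertices (w₁ ⧺ (c ⧺ w₂))
    keep (inj₁ z∈) = ∈-⧺ˡ w₁ _ z∈
    keep (inj₂ z∈) = ∈-⧺ʳ w₁ _ (∈-⧺ʳ c w₂ z∈)

  record Trail (X : E → Set) (u : V) : Set where
    constructor mkTrail
    field
      walk   : Walk G u u
      unique : Unique (walkEdges walk)
      within : All X (walkEdges walk)
    Visits : V → Set
    Visits z = z ∈ walkVertices walk
  open Trail public

  module _ {X : EdgeSet} (even : Even X) {u : V} where

    extend : ∀ (T : Trail (In X) u) {e x y} → In X e → Joins G e x y → Visits T x →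
      Σ (Trail (In X) u) λ T′ → (∀ {z} → Visits T z → Visits T′ z) × Visits T′ y
    extend T {e} e∈X j x∈ with e ∈ᵉ? walkEdges (walk T)
    ... | yes e∈ = T , id , proj₂ (edge-ends∈ (walk T) e∈ j)
    ... | no e∉ with w′ , u′ , from , keep , y∈ ← splice (walk T) (unique T) (even-△-closed even (walk T))
                       (proj₂ ∘ in-difference {X} (unique T) (within T)) x∈ (trans (△-∉ {X} _ e∉) e∈X) j
      = mkTrail w′ u′ (All.tabulate λ f∈ → back (from f∈)) , keep , y∈
      where
      back : ∀ {f} → In (X △ ⟦ walkEdges (walk T) ⟧) f ⊎ f ∈ walkEdges (walk T) → In X f
      back (inj₁ f∈) = proj₁ (in-difference {X} (unique T) (within T) f∈)
      back (inj₂ f∈) = All.lookup (within T) f∈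

    extend-along : ∀ (T : Trail (In X) u) {x y} (p : Walk G x y) → All (In X) (walkEdges p) → Visits T x →
      Σ (Trail (In X) u) λ T′ → (∀ {z} → Visits T z → Visits T′ z) × Visits T′ y
    extend-along T nil [] x∈ = T , id , x∈
    extend-along T (cons e j p) (e∈X ∷ ps) x∈ with T′ , keep , w∈ ← extend T e∈X j x∈
      with T″ , keep′ , y∈ ← extend-along T′ p ps w∈ = T″ , keep′ ∘ keep , y∈

    spanning-trail : (∀ v → Linked (In X) u v) → Σ (Trail (In X) u) λ T → ∀ v → Visits T v
    spanning-trail linked = proj₁ covering , λ v → All.lookup (proj₂ covering) (∈-allFin v)
      where
      cover : ∀ vs → Σ (Trail (In X) u) λ T → All (Visits T) vs
      cover [] = mkTrail nil [] [] , []
      cover (v ∷ vs) with T , all ← cover vs with T′ , keep , v∈ ← extend-along T (proj₁ (linked v)) (proj₂ (linked v)) (start∈ (walk T))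
        = T′ , v∈ ∷ All.map keep all
      covering = cover (allFin (nV G))

  module _ {A B : E → Set} (A? : Decidable A) (disjoint : ∀ {e} → A e → ¬ B e) (linkedB : ∀ u v → Linked B u v) where

    -- Each edge of `A` enters together with a `B`-walk that closes it. Walks may cancel one
    -- another, but only on edges of `B`; the last component shows that `e` is absent before its
    -- turn.
    even-superset : ∀ es → Unique es → All A es →
      ∃ λ X → Even X × All (In X) es × (∀ {e} → In X e → e ∈ es ⊎ B e)
    even-superset [] _ _ = ⟦ [] ⟧ , parity-∅ , [] , λ ()
    even-superset (e ∷ es) (e∉ ∷ u) (Ae ∷ As)
      with X , even , sub , sup ← even-superset es u As | p , ps ← linkedB (tgt e) (src e)
      = X △ ⟦ e ∷ walkEdges p ⟧ , even-△-closed even (cons e (joins-ends e) p)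
      , head ∷ All.tabulate tail , sup′
      where
      A∉p : ∀ {f} → A f → f ∉ walkEdges p
      A∉p Af f∈ = disjoint Af (All.lookup ps f∈)
      head : In (X △ ⟦ e ∷ walkEdges p ⟧) e
      head rewrite dec-true (e Fin.≟ e) refl | ∉⇒⟦⟧ (walkEdges p) (A∉p Ae) with X e in Xe
      ... | false = refl
      ... | true with sup Xe
      ...   | inj₁ e∈ = ⊥-elim (All.lookup e∉ e∈ refl)
      ...   | inj₂ Be = ⊥-elim (disjoint Ae Be)
      tail : ∀ {f} → f ∈ es → In (X △ ⟦ e ∷ walkEdges p ⟧) f
      tail f∈ = trans (△-∉ {X} (e ∷ walkEdges p) λ { (here refl) → All.lookup e∉ f∈ refl ; (there f∈p) → A∉p (All.lookup As f∈) f∈p })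
                      (All.lookup sub f∈)
      sup′ : ∀ {f} → In (X △ ⟦ e ∷ walkEdges p ⟧) f → f ∈ e ∷ es ⊎ B f
      sup′ {f} f∈ with f ∈ᵉ? (e ∷ walkEdges p)
      ... | yes (here refl) = inj₁ (here refl)
      ... | yes (there f∈p) = inj₂ (All.lookup ps f∈p)
      ... | no f∉ with sup (trans (sym (△-∉ {X} _ f∉)) f∈)
      ...   | inj₁ f∈es = inj₁ (there f∈es)
      ...   | inj₂ Bf   = inj₂ Bf

    spanning-closed-trail : (∀ u v → Linked A u v) → ∀ u → Σ (Trail (λ e → A e ⊎ B e) u) λ T → ∀ v → Visits T v
    spanning-closed-trail linkedA u
      with X , even , sub , sup ← even-superset (filter A? (allFin _)) (Uniqueₚ.filter⁺ A? (Uniqueₚ.allFin⁺ _)) (Allₚ.all-filter A? (allFin _))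
      with T , all ← spanning-trail even (λ v → linked-map (λ Ae → All.lookup sub (∈-filter⁺ A? (∈-allFin _) Ae)) (linkedA u v))
      = mkTrail (walk T) (unique T) (All.map (λ e∈ → classify (sup e∈)) (within T)) , all
      where
      classify : ∀ {e} → e ∈ filter A? (allFin _) ⊎ B e → A e ⊎ B e
      classify (inj₁ e∈) = inj₁ (proj₂ (∈-filter⁻ A? {xs = allFin _} e∈))
      classify (inj₂ Be) = inj₂ Be

-- Long closed trails in 2-edge-connected graphs

length-concatMap-≤ : ∀ {A B : Set} (f : A → List B) {d} → (∀ x → length (f x) ≤ d) → ∀ xs → length (concatMap f xs) ≤ length xs * d
length-concatMap-≤ f le []       = z≤n
length-concatMap-≤ f le (x ∷ xs) = ≤-trans (≤-reflexive (length-++ (f x))) (+-mono-≤ (le x) (length-concatMap-≤ f le xs))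

++⁻-unique : ∀ {A : Set} (xs : List A) {ys x} → Unique (xs ++ ys) → x ∈ xs → x ∈ ys → ⊥
++⁻-unique (x ∷ xs) (x∉ ∷ u) (here refl) x∈ = All.lookup x∉ (∈-++⁺ʳ xs x∈) refl
++⁻-unique (x ∷ xs) (x∉ ∷ u) (there y∈)  y∈′ = ++⁻-unique xs u y∈ y∈′

module TwoConnected (G : Graph) (loopless : Loopless G) (conn : EdgeConnected 2 G) where
  open InGraph G
  open Parity G

  avoiding : ∀ e u v → Linked (e ≢_) u v
  avoiding e u v with p , avoids ← conn ⁅ e ⁆ (s≤s (≤-reflexive (∣⁅x⁆∣≡1 e))) u v
    = p , All.map (λ f∉ → λ { refl → f∉ (x∈⁅x⁆ e) }) avoids

  MeetsOnlyAt : (S : V → Set) (z : V) → List E → Set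
  MeetsOnlyAt S z es = ∀ {f a b} → f ∈ es → Joins G f a b → S a → a ≡ z

  -- `S y → y ≡ z` is carried for the recursion: an edge put in front can touch `S` only at its far
  -- end, and then the rest of the walk starts in `S` and stops there.
  first-hit : ∀ {S : V → Set} (S? : Decidable S) {y w} (p : Walk G y w) → S w →
    ∃ λ z → S z × (S y → y ≡ z) × Σ (Walk G y z) λ q → (∀ {f} → f ∈ walkEdges q → f ∈ walkEdges p) × MeetsOnlyAt S z (walkEdges q)
  first-hit S? {y} p Sw with S? y
  first-hit S? {y} p          Sw | yes Sy = y , Sy , (λ _ → refl) , nil , (λ ()) , λ ()
  first-hit S? {y} nil        Sw | no ¬Sy = ⊥-elim (¬Sy Sw)
  first-hit {S} S? {y} (cons {w = x} e j p) Sw | no ¬Sy with z , Sz , start , q , sub , only ← first-hit S? p Sw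
    = z , Sz , ⊥-elim ∘ ¬Sy , cons e j q , (λ { (here refl) → here refl ; (there f∈) → there (sub f∈) })
    , λ { (here refl) k Sa → at-end j k Sa ; (there f∈) k Sa → only f∈ k Sa }
    where
    at-end : ∀ {a b} → Joins G e y x → Joins G e a b → S a → a ≡ z
    at-end (inj₁ refl) (inj₁ refl) Sa = ⊥-elim (¬Sy Sa)
    at-end (inj₁ refl) (inj₂ refl) Sa = start Sa
    at-end (inj₂ refl) (inj₁ refl) Sa = start Sa
    at-end (inj₂ refl) (inj₂ refl) Sa = ⊥-elim (¬Sy Sa)

  -- A common edge would have both ends in `S`, hence both equal to `z`, and would be a loop.
  meets-disjoint : ∀ {S : V → Set} {z es} → MeetsOnlyAt S z es → ∀ {u v} (p : Walk G u v) →
    (∀ {a} → a ∈ walkVertices p → S a) → ∀ {f} → f ∈ es → f ∉ walkEdges p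
  meets-disjoint only p inS {f} f∈ f∈p with s∈ , t∈ ← edge-ends∈ p f∈p (joins-ends f)
    = loopless f (trans (only f∈ (joins-ends f) (inS s∈)) (sym (only f∈ (swap (joins-ends f)) (inS t∈))))

  DisjointPair : V → V → Set
  DisjointPair x y = Σ (Walk G x y) λ p → Σ (Walk G x y) λ q → ∀ {f} → f ∈ walkEdges p → f ∉ walkEdges q

  swap-pair : ∀ {x y} → DisjointPair x y → DisjointPair x y
  swap-pair (p , q , disj) = q , p , λ f∈q f∈p → disj f∈p f∈q

  -- The closed walk p₁ p₂ q⁻¹ passes through y and splits there.
  reroute : ∀ {x w y} (p q : Walk G x w) → IsPath p → (∀ {f} → f ∈ walkEdges p → f ∉ walkEdges q) →
            y ∈ walkVertices p → DisjointPair x y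
  reroute p q path disj y∈ with p₁ , p₂ , refl ← splitAt p y∈ = p₁ , q ⧺ rev p₂ , λ f∈ f∈′ →
    [ disj (subst (_ ∈_) (sym (edges-⧺ p₁ p₂)) (∈-++⁺ˡ f∈))
    , ++⁻-unique (walkEdges p₁) (subst Unique (edges-⧺ p₁ p₂) (path-edges-unique _ path)) f∈ ∘ edges-rev⁻ p₂
    ]′ (edges-⧺⁻ q (rev p₂) f∈′)

  attach : ∀ {x w y z e} (p q : Walk G x w) → (∀ {f} → f ∈ walkEdges p → f ∉ walkEdges q) →
    (j : Joins G e w y) → y ∉ walkVertices p → (r : Walk G y z) → All (e ≢_) (walkEdges r) →
    (∀ {f} → f ∈ walkEdges r → f ∉ walkEdges q) → z ∈ walkVertices p → DisjointPair x y
  attach {e = e} p q disj j y∉ r avoids away z∈ with p₁ , p₂ , refl ← splitAt p z∈ =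
    p₁ ⧺ rev r , q ⧺ cons e j nil , λ f∈ f∈′ → clash (edges-⧺⁻ p₁ (rev r) f∈) (edges-⧺⁻ q _ f∈′)
    where
    in-p : ∀ {f} → f ∈ walkEdges p₁ → f ∈ walkEdges (p₁ ⧺ p₂)
    in-p f∈ = subst (_ ∈_) (sym (edges-⧺ p₁ p₂)) (∈-++⁺ˡ f∈)
    clash : ∀ {f} → f ∈ walkEdges p₁ ⊎ f ∈ walkEdges (rev r) → f ∈ walkEdges q ⊎ f ∈ e ∷ [] → ⊥
    clash (inj₁ f∈) (inj₁ f∈q)         = disj (in-p f∈) f∈q
    clash (inj₁ f∈) (inj₂ (here refl)) = y∉ (proj₂ (edge-ends∈ _ (in-p f∈) j))
    clash (inj₂ f∈) (inj₁ f∈q)         = away (edges-rev⁻ r f∈) f∈q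
    clash (inj₂ f∈) (inj₂ (here refl)) = All.lookup avoids (edges-rev⁻ r f∈) refl

  -- Menger's theorem for two paths, by induction along a walk. If `y` lies on one of the paths,
  -- `reroute` applies. Otherwise a walk from `y` avoiding `e` is followed to its first vertex on
  -- `p` or `q`: it completes the path it hits, and `e` completes the other.
  disjoint-pair-step : ∀ {x w y e} → Joins G e w y → DisjointPair x w → DisjointPair x y
  disjoint-pair-step {x} {w} {y} {e} j (p₀ , q₀ , disj₀) = go (shorten p₀) (shorten q₀)
    where
    go : (Σ (Walk G x w) λ p → IsPath p × (∀ {f} → f ∈ walkEdges p → f ∈ walkEdges p₀)) →
         (Σ (Walk G x w) λ q → IsPath q × (∀ {f} → f ∈ walkEdges q → f ∈ walkEdges q₀)) → DisjointPair x y
    go (p , path-p , p⊆) (q , path-q , q⊆) with y ∈ᵛ? walkVertices p | y ∈ᵛ? walkVertices q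
    ... | yes y∈p | _       = reroute p q path-p (λ f∈ f∈′ → disj₀ (p⊆ f∈) (q⊆ f∈′)) y∈p
    ... | no _    | yes y∈q = swap-pair (reroute q p path-q (λ f∈ f∈′ → disj₀ (p⊆ f∈′) (q⊆ f∈)) y∈q)
    ... | no y∉p  | no y∉q
      with r₀ , avoids ← avoiding e y w
      with z , z∈ , _ , r , sub , only ← first-hit {S = λ v → v ∈ walkVertices p ⊎ v ∈ walkVertices q}
             (λ v → (v ∈ᵛ? walkVertices p) ⊎-dec (v ∈ᵛ? walkVertices q)) r₀ (inj₁ (end∈ p))
      = [ attach p q (λ f∈ f∈′ → disj₀ (p⊆ f∈) (q⊆ f∈′)) j y∉p r avoids′ (meets-disjoint only q inj₂)
        , swap-pair ∘ attach q p (λ f∈ f∈′ → disj₀ (p⊆ f∈′) (q⊆ f∈)) j y∉q r avoids′ (meets-disjoint only p inj₁) ]′ z∈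
      where
      avoids′ : All (e ≢_) (walkEdges r)
      avoids′ = All.tabulate λ f∈ → All.lookup avoids (sub f∈)

  disjoint-pair : ∀ {x y} → Walk G y x → DisjointPair x y
  disjoint-pair nil          = nil , nil , λ ()
  disjoint-pair (cons e j p) = disjoint-pair-step (swap j) (disjoint-pair p)

  LongTrail : V → ℕ → Set
  LongTrail u N = Σ (Trail (λ _ → ⊤) u) λ T → ∃ λ vs → Unique vs × All (Visits T) vs × N ≤ length vs

  length-walkVertices : ∀ {u v} (p : Walk G u v) → length (walkVertices p) ≡ suc (length (walkEdges p))
  length-walkVertices nil          = refl
  length-walkVertices (cons _ _ p) = cong suc (length-walkVertices p)

  -- The two edge-disjoint walks, shortened to paths, form a closed trail. They may share vertices,
  -- so only those of `p` are counted; they are distinct and exceed its edges by one.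
  distant-long-trail : ∀ {N x y} → (∀ (p : Walk G x y) → N ≤ length (walkEdges p)) → LongTrail x N
  distant-long-trail {N} {x} {y} far with p₀ , _ ← conn Subset.⊥ (subst (_< 2) (sym (∣⊥∣≡0 (nE G))) (s≤s z≤n)) y x
    with p₁ , q₁ , disj ← disjoint-pair p₀
    with p , path-p , p⊆ ← shorten p₁ | q , path-q , q⊆ ← shorten (rev q₁)
    = mkTrail (p ⧺ q) (subst Unique (sym (edges-⧺ p q)) (Uniqueₚ.++⁺ (path-edges-unique p path-p) (path-edges-unique q path-q)
            λ (f∈p , f∈q) → disj (p⊆ f∈p) (edges-rev⁻ q₁ (q⊆ f∈q)))) (All.tabulate λ _ → tt)
    , walkVertices p , path-p , All.tabulate (∈-⧺ˡ p q)
    , ≤-trans (far p) (≤-trans (n≤1+n _) (≤-reflexive (sym (length-walkVertices p))))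

  Adjacent : V → V → Set
  Adjacent u v = ∃ λ e → Joins G e u v

  adjacent? : ∀ u v → Dec (Adjacent u v)
  adjacent? u v = any? λ e → ≡-dec Fin._≟_ Fin._≟_ (ends G e) (u , v) ⊎-dec ≡-dec Fin._≟_ Fin._≟_ (ends G e) (v , u)

  neighbours : V → List V
  neighbours v = filter (adjacent? v) (allFin (nV G))

  -- Repetitions are kept, as only membership and an upper bound on the length matter. Keeping `v`
  -- beside its neighbours makes the balls nested.
  ball : V → ℕ → List V
  ball x zero    = x ∷ []
  ball x (suc i) = concatMap (λ v → v ∷ neighbours v) (ball x i)

  ball-suc : ∀ {x} i {u v} → u ∈ ball x i → v ∈ u ∷ neighbours u → v ∈ ball x (suc i)
  ball-suc {x} i u∈ v∈ = ∈-concatMap⁺ (λ v → v ∷ neighbours v) {xs = ball x i} (lose u∈ v∈)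

  short-walk-in-ball : ∀ {x} k i {u v} → u ∈ ball x i → (p : Walk G u v) → length (walkEdges p) ≤ k → v ∈ ball x (k + i)
  short-walk-in-ball zero    i u∈ nil le = u∈
  short-walk-in-ball {x} (suc k) i {v = v} u∈ nil le = subst (λ m → v ∈ ball x m) (+-suc k i) (short-walk-in-ball k (suc i) (ball-suc i u∈ (here refl)) nil z≤n)
  short-walk-in-ball {x} (suc k) i {v = v} u∈ (cons {w = w} e j p) (s≤s le) = subst (λ m → v ∈ ball x m) (+-suc k i)
    (short-walk-in-ball k (suc i) (ball-suc i u∈ (there (∈-filter⁺ (adjacent? _) (∈-allFin w) (e , j)))) p le)

  length-ball : ∀ {d} → (∀ v → length (neighbours v) < d) → ∀ x i → length (ball x i) ≤ d ^ i
  length-ball small x zero    = ≤-refl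
  length-ball {d} small x (suc i) = ≤-trans (length-concatMap-≤ (λ v → v ∷ neighbours v) small (ball x i))
    (≤-trans (*-monoˡ-≤ d (length-ball small x i)) (≤-reflexive (*-comm (d ^ i) d)))

  even-closed-walk : ∀ {a} (p : Walk G a a) → Even ⟦ walkEdges p ⟧
  even-closed-walk {a} p v = trans (parity-walk p v) (xor-same (δ a v))

  ⟦⟧⇒∈ : ∀ {es f} → In ⟦ es ⟧ f → f ∈ es
  ⟦⟧⇒∈ {es} {f} in-f with f ∈ᵉ? es
  ... | yes f∈ = f∈
  ... | no  f∉ with () ← trans (sym in-f) (∉⇒⟦⟧ es f∉)

  module _ {v : V} where

    -- Half of an ear: out of `v` along `edge`, then back to the trail at `z`. Through
    -- `meets-disjoint`, the field `only` keeps `path` off the edges of the trail.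
    record Excursion (T : Trail (λ _ → ⊤) v) (w z : V) : Set where
      field
        edge   : E
        joins  : Joins G edge v w
        path   : Walk G w z
        avoids : edge ∉ walkEdges path
        only   : MeetsOnlyAt (Visits T) z (walkEdges path)

    visits? : (T : Trail (λ _ → ⊤) v) → Decidable (Visits T)
    visits? T z = z ∈ᵛ? walkVertices (walk T)

    excursion : ∀ T {w} → Adjacent v w → ∃ λ z → Visits T z × Excursion T w z
    excursion T {w} (e , j) with p , ps ← avoiding e w v
      with z , z∈ , _ , q , sub , only ← first-hit (visits? T) p (start∈ (walk T))
      = z , z∈ , record { edge = e ; joins = j ; path = q ; avoids = λ e∈ → All.lookup ps (sub e∈) refl ; only = only }

    Extends : Trail (λ _ → ⊤) v → V → Set
    Extends T w = Σ (Trail (λ _ → ⊤) v) λ T′ → (∀ {z} → Visits T z → Visits T′ z) × Visits T′ w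

    -- The closed walk may repeat edges, so it is not spliced in itself. Its edges of odd
    -- multiplicity form an even set, which contains `e` because `p` avoids `e`; a closed trail
    -- through `e` in that set is used instead.
    extend-by-closed-walk : ∀ T {w e} (j : Joins G e v w) (p : Walk G w v) → e ∉ walkEdges p →
      (∀ {f} → f ∈ e ∷ walkEdges p → f ∉ walkEdges (walk T)) → Extends T w
    extend-by-closed-walk T {e = e} j p e∉ away =
      let w′ , u′ , _ , keep , y∈ = splice (walk T) (unique T) (even-closed-walk (cons e j p)) (away ∘ ⟦⟧⇒∈)
                                      (start∈ (walk T)) e-in j
      in mkTrail w′ u′ (All.tabulate λ _ → tt) , keep , y∈
      where
      e-in : In ⟦ e ∷ walkEdges p ⟧ e
      e-in rewrite dec-true (e Fin.≟ e) refl | ∉⇒⟦⟧ (walkEdges p) e∉ = refl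

    -- If z = v, one excursion is a closed walk at v; otherwise the two close up through v. Their paths may
    -- overlap: only the parity of the closed walk and its single use of the edge to w matter.
    extend-by-excursions : ∀ T {w w′ z} → ¬ Visits T w → ¬ Visits T w′ → w ≢ w′ → Excursion T w z → Excursion T w′ z → Extends T w
    extend-by-excursions T {w} {w′} {z} w∉ w′∉ w≢w′ X X′ = go (v Fin.≟ z)
      where
      open Excursion
      new-edge : ∀ {e x} → Joins G e v x → ¬ Visits T x → e ∉ walkEdges (walk T)
      new-edge j x∉ e∈ = x∉ (proj₂ (edge-ends∈ (walk T) e∈ j))
      off : ∀ {x} (Y : Excursion T x z) {f} → f ∈ walkEdges (path Y) → f ∉ walkEdges (walk T)
      off Y = meets-disjoint (only Y) (walk T) id
      edges-differ : edge X ≢ edge X′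
      edges-differ eq with joins X | joins X′
      ... | inj₁ k | inj₁ k′ = w≢w′ (cong proj₂ (trans (sym k) (trans (cong (ends G) eq) k′)))
      ... | inj₁ k | inj₂ k′ = w∉ (subst (Visits T) (sym (cong proj₂ (trans (sym k) (trans (cong (ends G) eq) k′)))) (start∈ (walk T)))
      ... | inj₂ k | inj₁ k′ = w∉ (subst (Visits T) (sym (cong proj₁ (trans (sym k) (trans (cong (ends G) eq) k′)))) (start∈ (walk T)))
      ... | inj₂ k | inj₂ k′ = w≢w′ (cong proj₁ (trans (sym k) (trans (cong (ends G) eq) k′)))
      go : Dec (v ≡ z) → Extends T w
      go (yes refl) = extend-by-closed-walk T (joins X) (path X) (avoids X)
        λ { (here refl) → new-edge (joins X) w∉ ; (there f∈) → off X f∈ }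
      go (no v≢z) = extend-by-closed-walk T (joins X) (path X ⧺ (rev (path X′) ⧺ cons (edge X′) (swap (joins X′)) nil))
        (λ e∈ → fresh (edges-⧺⁻ (path X) _ e∈))
        λ { (here refl) → new-edge (joins X) w∉ ; (there f∈) → away (edges-⧺⁻ (path X) _ f∈) }
        where
        back = rev (path X′) ⧺ cons (edge X′) (swap (joins X′)) nil
        fresh : ¬ (edge X ∈ walkEdges (path X) ⊎ edge X ∈ walkEdges back)
        fresh (inj₁ e∈) = avoids X e∈
        fresh (inj₂ e∈) with edges-⧺⁻ (rev (path X′)) _ e∈
        -- `edge X` has its end `v` on the trail, which the path of `X′` meets only at `z`.
        ... | inj₁ e∈r       = v≢z (only X′ (edges-rev⁻ (path X′) e∈r) (joins X) (start∈ (walk T)))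
        ... | inj₂ (here eq) = edges-differ eq
        away : ∀ {f} → f ∈ walkEdges (path X) ⊎ f ∈ walkEdges back → f ∉ walkEdges (walk T)
        away (inj₁ f∈) = off X f∈
        away (inj₂ f∈) with edges-⧺⁻ (rev (path X′)) _ f∈
        ... | inj₁ f∈r         = off X′ (edges-rev⁻ (path X′) f∈r)
        ... | inj₂ (here refl) = new-edge (joins X′) w′∉

    -- If `T` visits at most `j` vertices, at least `j + 2` of the `2 (j + 1)` neighbours are
    -- unvisited. They outnumber the possible ends of their excursions, so two excursions end at the
    -- same vertex and extend `T`.
    longer-star-trail : ∀ {j} → 2 * suc j ≤ length (neighbours v) → LongTrail v j → LongTrail v (suc j)
    longer-star-trail {j} le (T , vs , u , all , j≤) = go (≤-<-connex (suc j) (length visited))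
      where
      visited unvisited : List V
      visited   = filter (visits? T) (allFin (nV G))
      unvisited = filter (¬? ∘ visits? T) (neighbours v)
      few : length visited < suc j → length visited < length unvisited
      few (s≤s le′) = ≰⇒> λ ge → <-irrefl refl (begin-strict
        2 * j                                                        <⟨ *-monoʳ-< 2 (n<1+n j) ⟩
        2 * suc j                                                    ≤⟨ le ⟩
        length (neighbours v)                                        ≡⟨ length-filter-split (visits? T) (neighbours v) ⟩
        length (filter (visits? T) (neighbours v)) + length unvisited ≤⟨ +-mono-≤ (unique-length-≤
           (Uniqueₚ.filter⁺ (visits? T) (Uniqueₚ.filter⁺ (adjacent? v) (Uniqueₚ.allFin⁺ _)))
           (All.tabulate λ x∈ → ∈-filter⁺ (visits? T) (∈-allFin _) (proj₂ (∈-filter⁻ (visits? T) {xs = neighbours v} x∈)))) ge ⟩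
        length visited + length visited                              ≤⟨ +-mono-≤ le′ le′ ⟩
        j + j                                                        ≡⟨ cong (j +_) (sym (+-identityʳ j)) ⟩
        2 * j                                                        ∎)
        where open ≤-Reasoning
      unvisited-unique : Unique unvisited
      unvisited-unique = Uniqueₚ.filter⁺ (¬? ∘ visits? T) (Uniqueₚ.filter⁺ (adjacent? v) (Uniqueₚ.allFin⁺ _))
      w∉ : ∀ {w} → w ∈ unvisited → ¬ Visits T w
      w∉ w∈ = proj₂ (∈-filter⁻ (¬? ∘ visits? T) {xs = neighbours v} w∈)
      explore : ∀ {w} → w ∈ unvisited → ∃ λ z → z ∈ visited × Excursion T w z
      explore w∈ with z , z∈ , X ← excursion T (proj₂ (∈-filter⁻ (adjacent? v) {xs = allFin _} (proj₁ (∈-filter⁻ (¬? ∘ visits? T) {xs = neighbours v} w∈))))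
        = z , ∈-filter⁺ (visits? T) (∈-allFin z) z∈ , X
      go : suc j ≤ length visited ⊎ length visited < suc j → LongTrail v (suc j)
      go (inj₁ many) = T , visited , Uniqueₚ.filter⁺ (visits? T) (Uniqueₚ.allFin⁺ _) , Allₚ.all-filter (visits? T) (allFin _) , many
      go (inj₂ lt) =
        let w , w′ , w∈ , w′∈ , w≢w′ , z , X , X′ = list-pigeonhole (Excursion T) visited unvisited-unique explore (few lt)
            T′ , keep , w∈′ = extend-by-excursions T (w∉ w∈) (w∉ w′∈) w≢w′ X X′
        in T′ , w ∷ vs , All.map (λ x∈ → λ { refl → w∉ w∈ x∈ }) all ∷ u , w∈′ ∷ All.map keep all , s≤s j≤

    star-long-trail : ∀ j → 2 * j ≤ length (neighbours v) → LongTrail v j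
    star-long-trail zero    le = mkTrail nil [] [] , [] , [] , [] , z≤n
    star-long-trail (suc j) le = longer-star-trail le (star-long-trail j (≤-trans (*-monoʳ-≤ 2 (n≤1+n j)) le))

  -- If every vertex has fewer than `2 * N` neighbours, the ball of radius `N` around `x` holds at
  -- most `suc (2 * N) ^ N` vertices, so some vertex lies farther away.
  long-trail : ∀ N → V → suc (2 * N) ^ N < nV G → ∃ λ u → LongTrail u N
  long-trail N x big with any? (λ v → 2 * N ≤? length (neighbours v))
  ... | yes (v , le) = v , star-long-trail N le
  ... | no  sparse   with y , y∉ ← ¬∀⟶∃¬ _ (λ y → y ∈ ball x N) (_∈ᵛ? ball x N)
                       (λ all → <⇒≱ big (≤-trans (≤-reflexive (sym (length-tabulate id)))
                         (≤-trans (unique-length-≤ (Uniqueₚ.allFin⁺ _) (All.tabulate λ {y} _ → all y))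
                           (length-ball (λ v → m≤n⇒m≤1+n (≰⇒> λ le → sparse (v , le))) x N))))
    = x , distant-long-trail {x = x} {y} λ p → ≮⇒≥ λ short → y∉ (subst (λ m → y ∈ ball x m) (+-identityʳ N)
        (short-walk-in-ball N 0 (here refl) p (<⇒≤ short)))

-- Cutting trails into the paths of an immersion

-- Positions of edges: as a trail repeats no edge, edge-disjointness of arcs reduces to disjointness
-- of sets of positions.
data At {A : Set} : List A → ℕ → A → Set where
  here  : ∀ {x xs} → At (x ∷ xs) zero x
  there : ∀ {x xs m y} → At xs m y → At (x ∷ xs) (suc m) y

At⇒∈ : ∀ {A : Set} {xs : List A} {m x} → At xs m x → x ∈ xs
At⇒∈ here      = here refl
At⇒∈ (there a) = there (At⇒∈ a)

At-position-unique : ∀ {A : Set} {xs : List A} {m n x} → Unique xs → At xs m x → At xs n x → m ≡ n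
At-position-unique _        here      here      = refl
At-position-unique (x∉ ∷ _) here      (there a) = ⊥-elim (All.lookup x∉ (At⇒∈ a) refl)
At-position-unique (x∉ ∷ _) (there a) here      = ⊥-elim (All.lookup x∉ (At⇒∈ a) refl)
At-position-unique (_ ∷ u)  (there a) (there b) = cong suc (At-position-unique u a b)

next : ∀ {k} → Fin (suc k) → Fin (suc k)
next {k} j = suc (toℕ j) mod suc k

Last : ∀ {k} → Fin (suc k) → Set
Last {k} j = toℕ j ≡ k × toℕ (next j) ≡ 0

next-or-last : ∀ {k} (j : Fin (suc k)) → toℕ (next j) ≡ suc (toℕ j) ⊎ Last j
next-or-last {k} j with m≤n⇒m<n∨m≡n (s≤s⁻¹ (toℕ<n j))
... | inj₁ j<k = inj₁ (trans (toℕ-fromℕ< _) (m<n⇒m%n≡m (s≤s j<k)))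
... | inj₂ j≡k = inj₂ (j≡k , trans (toℕ-fromℕ< _) (trans (cong (λ m → suc m % suc k) j≡k) (n%n≡0 (suc k))))

module Cyclic (G : Graph) where
  open InGraph G
  open Parity G

  -- Beyond the end it stays at the last vertex, so `segment` makes sense for all `a ≤ b`.
  vertexAt : ∀ {u v} → Walk G u v → ℕ → V
  vertexAt {u} p            zero    = u
  vertexAt {u} nil          (suc m) = u
  vertexAt     (cons _ _ p) (suc m) = vertexAt p m

  len : ∀ {u v} → Walk G u v → ℕ
  len p = length (walkEdges p)

  vertexAt-len : ∀ {u v} (p : Walk G u v) → vertexAt p (len p) ≡ v
  vertexAt-len nil          = refl
  vertexAt-len (cons _ _ p) = vertexAt-len p

  position : ∀ {u v z} (p : Walk G u v) → z ∈ walkVertices p → ∃ λ m → m ≤ len p × vertexAt p m ≡ z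
  position nil          (here refl) = 0 , z≤n , refl
  position (cons _ _ p) (here refl) = 0 , z≤n , refl
  position (cons _ _ p) (there z∈) with m , le , eq ← position p z∈ = suc m , s≤s le , eq

  segment : ∀ {u v} (p : Walk G u v) a b → a ≤ b → Σ (Walk G (vertexAt p a) (vertexAt p b)) λ s →
            ∀ {f} → f ∈ walkEdges s → ∃ λ m → At (walkEdges p) m f × a ≤ m × m < b
  segment p            zero    zero    _ = nil , λ ()
  segment nil          zero    (suc b) _ = nil , λ ()
  segment (cons e j p) zero    (suc b) _ with s , at ← segment p zero b z≤n = cons e j s , λ
    { (here refl) → 0 , here , z≤n , s≤s z≤n
    ; (there f∈) → let m , a , _ , lt = at f∈ in suc m , there a , z≤n , s≤s lt }
  segment nil          (suc a) (suc b) _ = nil , λ ()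
  segment (cons e j p) (suc a) (suc b) (s≤s le) with s , at ← segment p a b le = s , λ f∈ →
    let m , i , ge , lt = at f∈ in suc m , there i , s≤s ge , s≤s lt

  module _ {u} (w : Walk G u u) where

    -- The second alternative passes through the base point u.
    arc : ∀ {Wraps : Set} a b → a ≤ len w → a ≤ b ⊎ Wraps → Σ (Walk G (vertexAt w a) (vertexAt w b)) λ s →
          ∀ {f} → f ∈ walkEdges s → ∃ λ m → At (walkEdges w) m f × ((a ≤ m × m < b) ⊎ (Wraps × (a ≤ m ⊎ m < b)))
    arc a b a≤ (inj₁ a≤b) with s , at ← segment w a b a≤b = s , λ f∈ → let m , i , ge , lt = at f∈ in m , i , inj₁ (ge , lt)
    arc a b a≤ (inj₂ wr) with s₁ , at₁ ← segment w a (len w) a≤ | s₂ , at₂ ← segment w 0 b z≤n =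
      s₁′ ⧺ s₂ , λ f∈ → [ (λ f∈₁ → let m , i , ge , _ = edges₁ f∈₁ in m , i , inj₂ (wr , inj₁ ge))
                        , (λ f∈₂ → let m , i , _ , lt = at₂ f∈₂ in m , i , inj₂ (wr , inj₂ lt))
                        ]′ (edges-⧺⁻ s₁′ s₂ f∈)
      where
      s₁′ : Walk G (vertexAt w a) u
      s₁′ = subst (Walk G (vertexAt w a)) (vertexAt-len w) s₁
      edges₁ : ∀ {f} → f ∈ walkEdges s₁′ → ∃ λ m → At (walkEdges w) m f × a ≤ m × m < len w
      edges₁ = at₁ ∘ unsubst (vertexAt-len w)
        where
        unsubst : ∀ {f x y} {s : Walk G (vertexAt w a) x} (eq : x ≡ y) → f ∈ walkEdges (subst (Walk G (vertexAt w a)) eq s) → f ∈ walkEdges s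
        unsubst refl f∈ = f∈

  record Tour {k} (X : E → Set) (φ : Fin (suc k) → V) : Set where
    field
      step     : ∀ j → Walk G (φ j) (φ (next j))
      uses     : ∀ {j f} → f ∈ walkEdges (step j) → X f
      disjoint : ∀ {j j′ f} → j ≢ j′ → f ∈ walkEdges (step j) → f ∉ walkEdges (step j′)

  module _ {k u} {X : E → Set} {φ : Fin (suc k) → V} (T : Trail X u) (p : Fin (suc k) → ℕ)
           (p≤ : ∀ j → p j ≤ len (walk T)) (at-p : ∀ j → vertexAt (walk T) (p j) ≡ φ j) where

    private
      w = walk T

      Span : Set → Fin (suc k) → Fin (suc k) → ℕ → Set
      Span Wraps a b m = (p a ≤ m × m < p b) ⊎ (Wraps × (p a ≤ m ⊎ m < p b))

      Spans : (Fin (suc k) → ℕ → Set) → Fin (suc k) → Set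
      Spans S j = Σ (Walk G (φ j) (φ (next j))) λ s → ∀ {f} → f ∈ walkEdges s → ∃ λ m → At (walkEdges w) m f × S j m

      arc-between : ∀ {Wraps : Set} a b → p a ≤ p b ⊎ Wraps → Σ (Walk G (φ a) (φ b)) λ s →
            ∀ {f} → f ∈ walkEdges s → ∃ λ m → At (walkEdges w) m f × Span Wraps a b m
      arc-between {Wraps} a b or = subst₂ (λ x y → Σ (Walk G x y) λ s → ∀ {f} → f ∈ walkEdges s → ∃ λ m → At (walkEdges w) m f × Span Wraps a b m)
        (at-p a) (at-p b) (arc w (p a) (p b) (p≤ a) or)

      tour : ∀ {S : Fin (suc k) → ℕ → Set} → (∀ j → Spans S j) → (∀ {j j′ m} → j Fin.< j′ → S j m → S j′ m → ⊥) → Tour X φ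
      tour {S} spans apart = record
        { step = λ j → proj₁ (spans j)
        ; uses = λ {j} f∈ → All.lookup (within T) (At⇒∈ (proj₁ (proj₂ (proj₂ (spans j) f∈))))
        ; disjoint = λ {j} {j′} j≢ f∈ f∈′ →
            let m , i , s = proj₂ (spans j) f∈ ; m′ , i′ , s′ = proj₂ (spans j′) f∈′
            in clash j≢ s (subst (S j′) (At-position-unique (unique T) i′ i) s′) }
        where
        clash : ∀ {j j′ m} → j ≢ j′ → S j m → S j′ m → ⊥
        clash {j} {j′} j≢ s s′ with Finₚ.<-cmp j j′
        ... | tri< lt _ _ = apart lt s s′
        ... | tri≈ _ eq _ = j≢ eq
        ... | tri> _ _ gt = apart gt s′ s

      not-last : ∀ {j j′ : Fin (suc k)} → j Fin.< j′ → ¬ Last j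
      not-last {j} {j′} lt (j≡k , _) = <⇒≱ lt (subst (toℕ j′ ≤_) (sym j≡k) (s≤s⁻¹ (toℕ<n j′)))

      weaken : ∀ {R : ℕ → ℕ → Set} → (∀ {m} → R m m) → (∀ {j j′} → j Fin.< j′ → R (p j) (p j′)) →
               ∀ {j j′} → j Fin.≤ j′ → R (p j) (p j′)
      weaken {R} rfl strict {j} {j′} le with m≤n⇒m<n∨m≡n le
      ... | inj₁ lt = strict lt
      ... | inj₂ eq = subst (λ i → R (p j) (p i)) (toℕ-injective eq) rfl

      next≤ : ∀ {j j′ : Fin (suc k)} → j Fin.< j′ → next j Fin.≤ j′
      next≤ {j} lt with next-or-last j
      ... | inj₁ eq = subst (_≤ _) (sym eq) lt
      ... | inj₂ l  = ⊥-elim (not-last lt l)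

      next-of-last≤ : ∀ {i : Fin (suc k)} (j : Fin (suc k)) → Last j → next j Fin.≤ i
      next-of-last≤ j (_ , eq) = subst (_≤ _) (sym eq) z≤n

      j<next : ∀ (j : Fin (suc k)) → j Fin.< next j ⊎ Last j
      j<next j with next-or-last j
      ... | inj₁ eq = inj₁ (subst (toℕ j <_) (sym eq) (n<1+n _))
      ... | inj₂ l  = inj₂ l

    -- The arc of a non-last `j` occupies the positions from `p j` up to `p (next j)`, and these
    -- intervals are consecutive. The last arc occupies those before the first of them and after the
    -- last.
    increasing-tour : (∀ {j j′} → j Fin.< j′ → p j < p j′) → Tour X φ
    increasing-tour inc = tour (λ j → arc-between j (next j) (map₁ (<⇒≤ ∘ inc) (j<next j))) apart
      where
      mono : ∀ {j j′} → j Fin.≤ j′ → p j ≤ p j′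
      mono = weaken {_≤_} ≤-refl (<⇒≤ ∘ inc)
      apart : ∀ {j j′ m} → j Fin.< j′ → Span (Last j) j (next j) m → Span (Last j′) j′ (next j′) m → ⊥
      apart lt (inj₂ (l , _)) _ = not-last lt l
      apart lt (inj₁ (ge , m<)) (inj₁ (ge′ , _))             = <⇒≱ (<-≤-trans m< (mono (next≤ lt))) ge′
      apart lt (inj₁ (ge , m<)) (inj₂ (l , inj₁ ge′))        = <⇒≱ (<-≤-trans m< (mono (next≤ lt))) ge′
      apart lt (inj₁ (ge , m<)) (inj₂ (l , inj₂ m<′))        = <⇒≱ (<-≤-trans m<′ (mono (next-of-last≤ _ l))) ge

    -- Here the trail meets `next j` before `j`, so each arc is cut out from `next j` to `j` and
    -- then reversed.
    decreasing-tour : (∀ {j j′} → j Fin.< j′ → p j > p j′) → Tour X φ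
    decreasing-tour dec = tour (λ j → back j (arc-between (next j) j (map₁ (<⇒≤ ∘ dec) (j<next j)))) apart
      where
      S : Fin (suc k) → ℕ → Set
      S j = Span (Last j) (next j) j
      back : ∀ j → (Σ (Walk G (φ (next j)) (φ j)) λ s → ∀ {f} → f ∈ walkEdges s → ∃ λ m → At (walkEdges w) m f × S j m) → Spans S j
      back j (s , at) = rev s , at ∘ edges-rev⁻ s
      anti : ∀ {j j′} → j Fin.≤ j′ → p j′ ≤ p j
      anti = weaken {_≥_} ≤-refl (<⇒≤ ∘ dec)
      apart : ∀ {j j′ m} → j Fin.< j′ → S j m → S j′ m → ⊥
      apart lt (inj₂ (l , _)) _ = not-last lt l
      apart lt (inj₁ (ge , m<)) (inj₁ (_ , m<′))             = <⇒≱ (<-≤-trans m<′ (anti (next≤ lt))) ge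
      apart lt (inj₁ (ge , m<)) (inj₂ (l , inj₂ m<′))        = <⇒≱ (<-≤-trans m<′ (anti (next≤ lt))) ge
      apart lt (inj₁ (ge , m<)) (inj₂ (l , inj₁ ge′))        = <⇒≱ (<-≤-trans m< (anti (next-of-last≤ _ l))) ge′

  module _ {u} {X : E → Set} (T : Trail X u) where

    -- 0 off the trail.
    positionOf : V → ℕ
    positionOf z with z ∈ᵛ? walkVertices (walk T)
    ... | yes z∈ = proj₁ (position (walk T) z∈)
    ... | no _   = 0

    positionOf-correct : ∀ {z} → Visits T z → positionOf z ≤ len (walk T) × vertexAt (walk T) (positionOf z) ≡ z
    positionOf-correct {z} z∈ with z ∈ᵛ? walkVertices (walk T)
    ... | yes z∈′ = proj₂ (position (walk T) z∈′)
    ... | no z∉   = ⊥-elim (z∉ z∈)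

    positions-separate : ∀ {vs} → Unique vs → All (Visits T) vs → Separates positionOf vs
    positions-separate [] [] = []
    positions-separate (v∉ ∷ u) (v∈ ∷ all) = All.zipWith (λ (v≢x , x∈) eq → v≢x
      (trans (sym (proj₂ (positionOf-correct v∈))) (trans (cong (vertexAt (walk T)) eq) (proj₂ (positionOf-correct x∈))))) (v∉ , all)
      ∷ positions-separate u all

    monotone-tour : ∀ {k} vs → All (Visits T) vs → Monotone positionOf vs → (le : suc k ≤ length vs) →
      Tour X (λ j → lookup vs (inject≤ j le))
    monotone-tour {k} vs all mono le = go mono
      where
      φ : Fin (suc k) → V
      φ j = lookup vs (inject≤ j le)
      correct : ∀ j → positionOf (φ j) ≤ len (walk T) × vertexAt (walk T) (positionOf (φ j)) ≡ φ j
      correct j = positionOf-correct (All.lookup all (∈-lookup {xs = vs} (inject≤ j le)))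
      inject< : ∀ {j j′ : Fin (suc k)} → j Fin.< j′ → inject≤ j le Fin.< inject≤ j′ le
      inject< {j} {j′} = subst₂ _<_ (sym (toℕ-inject≤ j le)) (sym (toℕ-inject≤ j′ le))
      go : Monotone positionOf vs → Tour X φ
      go (inj₁ inc) = increasing-tour T (positionOf ∘ φ) (proj₁ ∘ correct) (proj₂ ∘ correct) (AllPairs-lookup inc ∘ inject<)
      go (inj₂ dec) = decreasing-tour T (positionOf ∘ φ) (proj₁ ∘ correct) (proj₂ ∘ correct) (AllPairs-lookup dec ∘ inject<)

  lookup-injective : ∀ {vs : List V} → Unique vs → ∀ {i j} → lookup vs i ≡ lookup vs j → i ≡ j
  lookup-injective u {i} {j} eq with Finₚ.<-cmp i j
  ... | tri< lt _ _ = ⊥-elim (AllPairs-lookup u lt eq)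
  ... | tri≈ _ i≡j _ = i≡j
  ... | tri> _ _ gt = ⊥-elim (AllPairs-lookup u gt (sym eq))

  -- The `i`-th of the parallel edges from `j` to `next j` follows the `j`-th arc of the `i`-th
  -- trail. Two edges of the cycle differ in the trail or in the arc, and shortening an arc to a
  -- path adds no edges.
  immersion-from-trails : ∀ {t k} {X : Fin t → E → Set} {root : Fin t → V} (T : ∀ i → Trail (X i) (root i)) →
    (∀ {i i′ e} → i ≢ i′ → X i e → ¬ X i′ e) → ∀ {vs} → Unique vs → (∀ i → All (Visits (T i)) vs) →
    commonBound t (suc (suc k)) ≤ length vs → Immersed (C t (suc (suc k))) G
  immersion-from-trails {t} {k} {X} T apart {vs} u all le =
    go (common-monotone-sublist t (suc (suc k)) (positionOf ∘ T) vs (λ i → positions-separate (T i) u (all i)) le)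
    where
    go : (∃ λ ys → ys ⊆ vs × suc (suc k) ≤ length ys × (∀ i → Monotone (positionOf (T i)) ys)) → Immersed (C t (suc (suc k))) G
    go (ys , τ , r≤ , mono) = φ , φ-injective
      , (λ h → proj₁ (path h)) , (λ h → proj₁ (proj₂ (path h)))
      , λ h h′ h≢h′ e e∈ e∈′ → disjoint′ h h′ h≢h′ (proj₂ (proj₂ (path h)) e∈) (proj₂ (proj₂ (path h′)) e∈′)
      where
      φ : Fin (suc (suc k)) → V
      φ j = lookup ys (inject≤ j r≤)
      φ-injective : Injective _≡_ _≡_ φ
      φ-injective eq = Finₚ.inject≤-injective r≤ r≤ _ _ (lookup-injective (AllPairs-resp-⊆ τ u) eq)
      tours : ∀ i → Tour (X i) φ
      tours i = monotone-tour (T i) ys (All-resp-⊆ τ (all i)) (mono i) r≤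
      j-of : Fin (suc (suc k) * t) → Fin (suc (suc k))
      j-of = quotient t
      i-of : Fin (suc (suc k) * t) → Fin t
      i-of = remainder {suc (suc k)} t
      route : ∀ h → Walk G (φ (j-of h)) (φ (next (j-of h)))
      route h = Tour.step (tours (i-of h)) (j-of h)
      path : ∀ h → Σ (Walk G (φ (j-of h)) (φ (next (j-of h)))) λ q → IsPath q × (∀ {e} → e ∈ walkEdges q → e ∈ walkEdges (route h))
      path h = shorten (route h)
      disjoint′ : ∀ h h′ → h ≢ h′ → ∀ {e} → e ∈ walkEdges (route h) → e ∈ walkEdges (route h′) → ⊥
      disjoint′ h h′ h≢h′ e∈ e∈′ with i-of h Fin.≟ i-of h′
      ... | no i≢i′ = apart i≢i′ (Tour.uses (tours (i-of h)) e∈) (Tour.uses (tours (i-of h′)) e∈′)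
      ... | yes eq  = Tour.disjoint (tours (i-of h′)) j≢j′ (subst (λ i → _ ∈ walkEdges (Tour.step (tours i) (j-of h))) eq e∈) e∈′
        where
        j≢j′ : j-of h ≢ j-of h′
        j≢j′ eq′ = h≢h′ (trans (sym (combine-remQuot {suc (suc k)} t h)) (trans (cong₂ combine eq′ eq) (combine-remQuot {suc (suc k)} t h′)))

-- Connectivity arithmetic and assembly of the cases

edge-connected-mono : ∀ {k k′ G} → k ≤ k′ → EdgeConnected k′ G → EdgeConnected k G
edge-connected-mono le conn F small = conn F (<-≤-trans small le)

-- The slack is `2 * t`: the inequality is tight for multiplicity 2, and its analogue for
-- multiplicity 1 fails.
connectivity-suffices : ∀ t → 2 * (suc (suc t) * 2) ≤ 6 * suc (suc t) ∸ 4
connectivity-suffices t = m+n≤o⇒m≤o∸n _ (subst (2 * (suc (suc t) * 2) + 4 ≤_) eq (m≤m+n _ (2 * t)))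
  where
  open +-*-Solver
  eq : 2 * (suc (suc t) * 2) + 4 + 2 * t ≡ 6 * suc (suc t)
  eq = solve 1 (λ t → con 2 :* ((con 2 :+ t) :* con 2) :+ con 4 :+ con 2 :* t := con 6 :* (con 2 :+ t)) refl t

single-cycle : ∀ k {G} → Loopless G → EdgeConnected 2 G →
  let N = commonBound 1 (suc (suc k)) in suc (2 * N) ^ N < nV G → Immersed (C 1 (suc (suc k))) G
single-cycle k {G} loopless conn big =
  let _ , T , vs , u , all , le = TwoConnected.long-trail G loopless conn _ (fromℕ< big) big
  in Cyclic.immersion-from-trails G {t = 1} {k} {λ _ _ → ⊤} (λ _ → T) (λ { {zero} {zero} i≢i _ _ → i≢i refl }) u (λ _ → all) le

multiple-cycle : ∀ t k {G} → EdgeConnected (2 * (suc t * 2)) G →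
  commonBound (suc t) (suc (suc k)) < nV G → Immersed (C (suc t) (suc (suc k))) G
multiple-cycle t k {G} conn big = Cyclic.immersion-from-trails G {X = X} (λ i → proj₁ (trail i)) apart
  (Uniqueₚ.allFin⁺ (nV G)) (λ i → All.tabulate λ {v} _ → proj₂ (trail i) v)
  (≤-trans (<⇒≤ big) (≤-reflexive (sym (length-tabulate id))))
  where
  open InGraph G
  open Packing G
  open Parity G
  colouring : ∃ λ c → ∀ i u v → Linked (Class c i) u v
  colouring = packing conn
  c = proj₁ colouring
  -- A colour encodes a pair of a trail `i` and one of its two halves `b`.
  half : Fin 2 → Fin (suc t) → E → Set
  half b i = Class c (combine i b)
  X : Fin (suc t) → E → Set
  X i e = half zero i e ⊎ half (suc zero) i e
  owner : ∀ {i e} → X i e → ∃ λ b → Vec.lookup c e ≡ combine i b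
  owner (inj₁ eq) = zero , eq
  owner (inj₂ eq) = suc zero , eq
  apart : ∀ {i i′ e} → i ≢ i′ → X i e → ¬ X i′ e
  apart {i} {i′} i≢i′ x x′ with b , eq ← owner {i} x | b′ , eq′ ← owner {i′} x′ = i≢i′ (combine-injectiveˡ i b i′ b′ (trans (sym eq) eq′))
  halves-disjoint : ∀ {i e} → half zero i e → ¬ half (suc zero) i e
  halves-disjoint {i} eq eq′ with () ← combine-injectiveʳ i zero i (suc zero) (trans (sym eq) eq′)
  trail : ∀ i → Σ (Trail (X i) (fromℕ< big)) λ T → ∀ v → Visits T v
  trail i = spanning-closed-trail (class? c (combine i zero)) (halves-disjoint {i}) (proj₂ colouring _) (proj₂ colouring _) (fromℕ< big)

theorem1p5 : (t r : ℕ) → 1 ≤ t → 1 ≤ r →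
    ∃ λ (f : ℕ) → (G : Graph) → Loopless G →
    EdgeConnected (6 * t ∸ 4) G → f ≤ nV G → Immersed (C t r) G
theorem1p5 t 1 _ _ = 1 , λ G _ _ nonempty → (λ _ → fromℕ< nonempty) , (λ { {zero} {zero} _ → refl }) , (λ ()) , (λ ()) , λ ()
theorem1p5 1 (suc (suc k)) _ _ = _ , λ G loopless conn → single-cycle k loopless conn
theorem1p5 (suc (suc t)) (suc (suc k)) _ _ = _ , λ G _ conn → multiple-cycle (suc t) k (edge-connected-mono {G = G} (connectivity-suffices t) conn)
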